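{- Let $m$ be a positive integer and let $\gamma=\gamma_1\cdots\gamma_m\in\mathcal S_m(132)$ be any permutation with $\gamma_1=m-1$, $\gamma_{m-1}=m$ and $\gamma_m=1$. Let $B=B(t,x)=\sum_{n\ge 0}t^n\sum_{\sigma\in\mathcal S_n(132)}x^{\gamma\text{ -mch}(\sigma)}$. Then $B$ satisfies the recursion $$B=\frac{tB^{3}}{B-1}+t^{m-3}(x-1)(B-1-tB).$$
   Context: $\mathcal S_n$ is the set of permutations of $\{1,\dots,n\}$ in one-line notation ($\mathcal S_0$ contains only the empty permutation, on which all statistics are $0$). For a word $w$ of distinct integers, $\mathrm{red}(w)$ replaces the $i$-th smallest letter by $i$. $\sigma\in\mathcal S_n$ avoids $\lambda\in\mathcal S_k$ (classical avoidance) if no (not necessarily contiguous) subsequence $\sigma_{i_1}\cdots\sigma_{i_k}$, $i_1<\dots<i_k$, has reduction $\lambda$; $\mathcal S_n(\lambda)$ is the set of such $\sigma$. $\gamma\text{ -mch}(\sigma)$ is the number of $i$ with $\mathrm{red}(\sigma_i\sigma_{i+1}\cdots\sigma_{i+k-1})=\gamma$ for $\gamma\in\mathcal S_k$.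
   Formalization: The case m = 3 (γ = 231) is excluded: there the recursion fails, since after multiplying by B−1 the two sides differ by t(x−1)²(B−1)³, which is nonzero; all other m are covered. -}

module Defs where

open import Algebra.Bundles.Raw using (RawRing)
import Algebra.Definitions.RawSemiring as RawSemiringDefs
open import Data.Integer.Base using (+-*-rawRing)
open import Data.List.Base
  using (List; []; _∷_; _++_; map; foldr; length; filter; take; drop; head; tails; upTo;
         cartesianProductWith)
open import Data.List.Properties using (≡-dec)
open import Data.List.Relation.Unary.All using (All; all?)
open import Data.List.Relation.Unary.Unique.DecPropositional using (unique?)
open import Data.Maybe.Base using (Maybe; nothing)
open import Data.Nat.Base using (ℕ; zero; suc; _∸_)
open import Data.Nat.Properties using (_≟_; _≤?_)
open import Data.Product.Base using (_×_)
open import Relation.Binary.Definitions using (DecidableEquality)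
open import Relation.Binary.PropositionalEquality.Core using (_≢_)
open import Relation.Nullary.Decidable using (¬?)
open import Relation.Unary using (Decidable)

Word : Set
Word = List ℕ

_≟ʷ_ : DecidableEquality Word
_≟ʷ_ = ≡-dec _≟_

-- Letters are numbered from 1, as in σ = σ₁ ⋯ σₙ.
letter : Word → ℕ → Maybe ℕ
letter w zero    = nothing
letter w (suc i) = head (drop i w)

words : ℕ → List ℕ → List Word
words zero    as = [] ∷ []
words (suc n) as = cartesianProductWith _∷_ as (words n as)

-- One-line notation: words of length n over {1, …, n} with distinct letters.
-- Every permutation is listed exactly once.
𝒮 : ℕ → List Word
𝒮 n = filter (unique? _≟_) (words n (map suc (upTo n)))

-- When the letters are distinct, the i-th smallest one is the one with exactly
-- i letters less than or equal to it.
red : Word → Word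
red w = map (λ a → length (filter (_≤? a) w)) w

subsequences : Word → List Word
subsequences []      = [] ∷ []
subsequences (a ∷ w) = map (a ∷_) (subsequences w) ++ subsequences w

Avoids : Word → Word → Set
Avoids p σ = All (λ w → red w ≢ p) (subsequences σ)

avoids? : ∀ p → Decidable (Avoids p)
avoids? p σ = all? (λ w → ¬? (red w ≟ʷ p)) (subsequences σ)

𝒮-avoiding : Word → ℕ → List Word
𝒮-avoiding p n = filter (avoids? p) (𝒮 n)

132-pattern : Word
132-pattern = 1 ∷ 3 ∷ 2 ∷ []

-- The candidate windows are the initial segments of the suffixes of σ.  A suffix
-- shorter than γ gives a window that is too short to reduce to γ.
mch : Word → Word → ℕ
mch γ σ = length (filter (λ v → red (take (length γ) v) ≟ʷ γ) (tails σ))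

module _ {c ℓ} (R : RawRing c ℓ) where
  open RawRing R

  ∑ : List Carrier → Carrier
  ∑ = foldr _+_ 0#

  const : Carrier → ℕ → Carrier
  const a zero    = a
  const a (suc _) = 0#

  -- Formal power series in one variable over R, with the Cauchy product.
  Series : RawRing c ℓ
  Series = record
    { Carrier = ℕ → Carrier
    ; _≈_     = λ f g → ∀ n → f n ≈ g n
    ; _+_     = λ f g n → f n + g n
    ; _*_     = λ f g n → ∑ (map (λ i → f i * g (n ∸ i)) (upTo (suc n)))
    ; -_      = λ f n → - f n
    ; 0#      = λ _ → 0#
    ; 1#      = const 1#
    }

  var : ℕ → Carrier
  var 1 = 1#
  var _ = 0#

-- ℤ⟦x⟧⟦t⟧ contains ℤ[x]⟦t⟧, where the generating function lives.
ℤ⟦x⟧ : RawRing _ _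
ℤ⟦x⟧ = Series +-*-rawRing

ℤ⟦x⟧⟦t⟧ : RawRing _ _
ℤ⟦x⟧⟦t⟧ = Series ℤ⟦x⟧

open RawRing ℤ⟦x⟧⟦t⟧ public using (Carrier; _≈_; _+_; _*_; -_; 1#)
open RawSemiringDefs (RawRing.rawSemiring ℤ⟦x⟧⟦t⟧) public using (_^_)

infixl 6 _-_
_-_ : Carrier → Carrier → Carrier
f - g = f + (- g)

t x : Carrier
t = var ℤ⟦x⟧
x = const ℤ⟦x⟧ (var +-*-rawRing)

B : Word → Carrier
B γ n = ∑ ℤ⟦x⟧ (map (λ σ → var +-*-rawRing ^ₓ mch γ σ) (𝒮-avoiding 132-pattern n))
  where open RawSemiringDefs (RawRing.rawSemiring ℤ⟦x⟧) renaming (_^_ to _^ₓ_)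

-- q is the fraction f / g: the one and only series with q g = f.
IsQuotient : Carrier → Carrier → Carrier → Set
IsQuotient f g q = q * g ≈ f × (∀ q′ → q′ * g ≈ f → q′ ≈ q)

{-# OPTIONS --safe #-}
-- Removing the largest letter splits a 132-avoiding permutation as α n β with every letter of
-- α above every letter of β.  Write γ = (δ + 1) m 1 with δ = (m - 2) τ.  A match of γ that
-- contains n has n as its last but one letter, so it exists exactly when α ends in a copy of δ
-- and β is nonempty; likewise α n β ends in δ iff β does or β = τ.  With E counting the
-- permutations that end in δ and F = B + (x - 1) E this gives
--   B = 1 + t (B + F (B - 1)),   E = t F (E + t^(m - 3)),
-- and eliminating E proves the recursion.  The quotient is unique because B - 1 is t times a
-- series with constant term 1.
module Submission where

open import Algebra.Bundles using (CommutativeRing)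
open import Algebra.Bundles.Raw using (RawRing)
import Algebra.Properties.CommutativeSemigroup as CommutativeSemigroupProperties
import Algebra.Properties.Group as GroupProperties
import Algebra.Properties.Ring as RingProperties
import Algebra.Properties.Semiring.Exp as SemiringExp
import Algebra.Properties.Semiring.Mult as SemiringMult
import Algebra.Solver.Ring.NaturalCoefficients.Default as SemiringSolver
open import Data.Bool.Base using (if_then_else_; true; false)
open import Data.Integer.Base using (+-*-rawRing)
open import Data.Integer.Properties using (+-*-commutativeRing)
open import Data.List.Base
  using (List; []; _∷_; [_]; _++_; map; length; upTo; applyUpTo; filter; cartesianProductWith;
         concatMap; tails; take; drop; head)
open import Data.List.Properties
open import Data.List.Membership.Propositional using (_∈_; _∉_)
open import Data.List.Membership.Propositional.Properties
open import Data.List.Membership.Propositional.Properties.WithK using (unique∧set⇒bag)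
open import Data.List.Relation.Binary.BagAndSetEquality using (∼bag⇒↭)
open import Data.List.Relation.Binary.Permutation.Propositional as Perm using (_↭_)
open import Data.List.Relation.Binary.Sublist.Propositional using (_⊆_; []; _∷_; _∷ʳ_; from∈)
import Data.List.Relation.Binary.Sublist.Propositional.Properties as Sub
open import Data.List.Relation.Unary.All as All using (All; []; _∷_)
import Data.List.Relation.Unary.All.Properties as Allₚ
open import Data.List.Relation.Unary.AllPairs as AllPairs using (AllPairs; []; _∷_)
import Data.List.Relation.Unary.AllPairs.Properties as AllPairsₚ
open import Data.List.Relation.Unary.Any using (here; there)
open import Data.List.Relation.Unary.Unique.Propositional using (Unique)
import Data.List.Relation.Unary.Unique.Propositional.Properties as Uniqueₚ
open import Data.Maybe.Base using (just)
open import Data.Maybe.Properties using (just-injective)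
open import Data.Nat.Base as ℕ using (ℕ; zero; suc; _∸_; _≤_; _<_; z≤n; s≤s)
import Data.Nat.Properties as ℕₚ
open import Data.Nat.Solver using (module +-*-Solver)
open import Data.Product.Base using (∃; ∃₂; _×_; _,_; proj₁; proj₂)
open import Data.Sum.Base using (_⊎_; inj₁; inj₂)
open import Data.Empty using (⊥; ⊥-elim)
open import Function.Base using (_∘_; case_of_)
open import Function.Bundles using (mk⇔)
open import Relation.Binary.Definitions using (tri<; tri≈; tri>)
open import Relation.Binary.PropositionalEquality as ≡ using (_≡_; _≢_; cong; cong₂; subst)
import Relation.Binary.Reasoning.Setoid as SetoidReasoning
open import Relation.Nullary using (¬_; Dec; does; yes; no; contradiction)
open import Relation.Nullary.Decidable using (¬?; dec-true; dec-false)
open import Relation.Unary using (Pred; Decidable)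
open import Defs
  using (Word; letter; words; red; subsequences; Avoids; avoids?; 𝒮-avoiding; 132-pattern; mch; _≟ʷ_;
         ∑; Series; const; var)

-- A match created by n straddles α and β, yet it depends only on how α ends and on whether β is
-- empty. F therefore charges this match to α in advance, and the terms B and B - 1 in the first
-- equation separate empty from nonempty β. The equation for E has no such correction: if α n β ends
-- in δ, then β ends in δ or equals τ, and in both cases β is nonempty because τ is. This is where m
-- ≠ 3 enters. For m = 3 the word τ is empty, the case β = τ contributes t B instead of t F to E,
-- and the recursion fails. For m = 1 and m = 2 no γ meets the conditions on its letters. The
-- summand t^(m - 3) is the contribution of the single permutation τ, which is too short to contain
-- a match of γ.

-- Formal power series over a commutative ring

module Cauchy {c ℓ} (R : CommutativeRing c ℓ) where
  open CommutativeRing R hiding (zero)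
  open SetoidReasoning setoid
  open CommutativeSemigroupProperties +-commutativeSemigroup using (interchange; x∙yz≈y∙xz)

  private module S = RawRing (Series rawRing)

  -- Recursion on the degree replaces the sum over `upTo`, so that the ring laws follow by induction
  -- with the first factor shifted to `f ∘ suc`.
  conv : S.Carrier → S.Carrier → S.Carrier
  conv f g zero    = f 0 * g 0
  conv f g (suc n) = f 0 * g (suc n) + conv (f ∘ suc) g n

  *≈conv : ∀ f g → f S.* g S.≈ conv f g
  *≈conv f g zero    = +-identityʳ _
  *≈conv f g (suc n) = +-congˡ (trans
    (reflexive (≡.cong (∑ rawRing) (≡.trans (map-applyUpTo suc _ (suc n))
                                            (≡.sym (map-upTo _ (suc n))))))
    (*≈conv (f ∘ suc) g n))

  conv-cong : ∀ {f f′ g g′} → f S.≈ f′ → g S.≈ g′ → conv f g S.≈ conv f′ g′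
  conv-cong p q zero    = *-cong (p 0) (q 0)
  conv-cong p q (suc n) = +-cong (*-cong (p 0) (q (suc n))) (conv-cong (p ∘ suc) q n)

  conv-zeroˡ : ∀ {f} g → (∀ k → f k ≈ 0#) → ∀ n → conv f g n ≈ 0#
  conv-zeroˡ g p zero    = trans (*-congʳ (p 0)) (zeroˡ _)
  conv-zeroˡ g p (suc n) = trans
    (+-cong (trans (*-congʳ (p 0)) (zeroˡ _)) (conv-zeroˡ g (p ∘ suc) n)) (+-identityˡ 0#)

  conv-scaleˡ : ∀ a f g n → conv (λ k → a * f k) g n ≈ a * conv f g n
  conv-scaleˡ a f g zero    = *-assoc a _ _
  conv-scaleˡ a f g (suc n) =
    trans (+-cong (*-assoc a _ _) (conv-scaleˡ a (f ∘ suc) g n)) (sym (distribˡ a _ _))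

  conv-+ˡ : ∀ f f′ g n → conv (f S.+ f′) g n ≈ conv f g n + conv f′ g n
  conv-+ˡ f f′ g zero    = distribʳ _ _ _
  conv-+ˡ f f′ g (suc n) =
    trans (+-cong (distribʳ _ _ _) (conv-+ˡ (f ∘ suc) (f′ ∘ suc) g n)) (interchange _ _ _ _)

  -- The mirror image of the defining recursion: here the top coefficient of `f` is split off.
  -- Comparing the two recursions gives commutativity.
  conv-sucʳ : ∀ f g n → conv f g (suc n) ≈ f (suc n) * g 0 + conv f (g ∘ suc) n
  conv-sucʳ f g zero    = +-comm _ _
  conv-sucʳ f g (suc n) = trans (+-congˡ (conv-sucʳ (f ∘ suc) g n)) (x∙yz≈y∙xz _ _ _)

  conv-comm : ∀ f g → conv f g S.≈ conv g f
  conv-comm f g zero    = *-comm _ _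
  conv-comm f g (suc n) =
    trans (+-cong (*-comm _ _) (conv-comm (f ∘ suc) g n)) (sym (conv-sucʳ g f n))

  conv-assoc : ∀ f g h → conv (conv f g) h S.≈ conv f (conv g h)
  conv-assoc f g h zero    = *-assoc _ _ _
  conv-assoc f g h (suc n) = begin
    f 0 * g 0 * h (suc n) + conv (λ k → f 0 * g (suc k) + conv (f ∘ suc) g k) h n
      ≈⟨ +-congˡ (conv-+ˡ (λ k → f 0 * g (suc k)) (conv (f ∘ suc) g) h n) ⟩
    f 0 * g 0 * h (suc n) + (conv (λ k → f 0 * g (suc k)) h n + conv (conv (f ∘ suc) g) h n)
      ≈⟨ +-assoc _ _ _ ⟨
    f 0 * g 0 * h (suc n) + conv (λ k → f 0 * g (suc k)) h n + conv (conv (f ∘ suc) g) h n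
      ≈⟨ +-cong (+-cong (*-assoc _ _ _) (conv-scaleˡ (f 0) (g ∘ suc) h n))
                (conv-assoc (f ∘ suc) g h n) ⟩
    f 0 * (g 0 * h (suc n)) + f 0 * conv (g ∘ suc) h n + conv (f ∘ suc) (conv g h) n
      ≈⟨ +-congʳ (distribˡ _ _ _) ⟨
    f 0 * conv g h (suc n) + conv (f ∘ suc) (conv g h) n ∎

  const-* : ∀ a f n → (const rawRing a S.* f) n ≈ a * f n
  const-* a f n = trans (*≈conv (const rawRing a) f n) (go n)
    where
    go : ∀ n → conv (const rawRing a) f n ≈ a * f n
    go zero    = refl
    go (suc n) = trans (+-congˡ (conv-zeroˡ f (λ _ → refl) n)) (+-identityʳ _)

  -- The operations are those of `Series rawRing`, so two applications to the integers give the very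
  -- ring of the statement.
  series : CommutativeRing c ℓ
  series = record
    { isCommutativeRing = record
      { isRing = record
        { +-isAbelianGroup = record
          { isGroup = record
            { isMonoid = record
              { isSemigroup = record
                { isMagma = record
                  { isEquivalence = record
                    { refl  = λ _ → refl
                    ; sym   = λ p n → sym (p n)
                    ; trans = λ p q n → trans (p n) (q n)
                    }
                  ; ∙-cong = λ p q n → +-cong (p n) (q n)
                  }
                ; assoc = λ f g h n → +-assoc (f n) (g n) (h n)
                }
              ; identity = (λ f n → +-identityˡ (f n)) , (λ f n → +-identityʳ (f n))
              }
            ; inverse = (λ f n → -‿inverseˡ (f n)) , (λ f n → -‿inverseʳ (f n))
            ; ⁻¹-cong = λ p n → -‿cong (p n)
            }
          ; comm = λ f g n → +-comm (f n) (g n)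
          }
        ; *-cong     = ⊛-cong
        ; *-assoc    = ⊛-assoc
        ; *-identity = ⊛-identityˡ , λ f n → trans (⊛-comm f S.1# n) (⊛-identityˡ f n)
        ; distrib    = (λ f g h n → trans (⊛-comm f (g S.+ h) n) (trans (⊛-distribʳ f g h n)
                         (+-cong (⊛-comm g f n) (⊛-comm h f n))))
                     , ⊛-distribʳ
        }
      ; *-comm = ⊛-comm
      }
    }
    where
    ⊛-cong : ∀ {f f′ g g′} → f S.≈ f′ → g S.≈ g′ → f S.* g S.≈ f′ S.* g′
    ⊛-cong {f} {f′} {g} {g′} p q n =
      trans (*≈conv f g n) (trans (conv-cong p q n) (sym (*≈conv f′ g′ n)))
    ⊛-comm : ∀ f g → f S.* g S.≈ g S.* f
    ⊛-comm f g n = trans (*≈conv f g n) (trans (conv-comm f g n) (sym (*≈conv g f n)))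
    ⊛-assoc : ∀ f g h → (f S.* g) S.* h S.≈ f S.* (g S.* h)
    ⊛-assoc f g h n = begin
      ((f S.* g) S.* h) n  ≈⟨ *≈conv (f S.* g) h n ⟩
      conv (f S.* g) h n   ≈⟨ conv-cong (*≈conv f g) (λ _ → refl) n ⟩
      conv (conv f g) h n  ≈⟨ conv-assoc f g h n ⟩
      conv f (conv g h) n  ≈⟨ conv-cong (λ _ → refl) (*≈conv g h) n ⟨
      conv f (g S.* h) n   ≈⟨ *≈conv f (g S.* h) n ⟨
      (f S.* (g S.* h)) n  ∎
    ⊛-identityˡ : ∀ f → S.1# S.* f S.≈ f
    ⊛-identityˡ f n = trans (const-* 1# f n) (*-identityˡ (f n))
    ⊛-distribʳ : ∀ h f g → (f S.+ g) S.* h S.≈ f S.* h S.+ g S.* h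
    ⊛-distribʳ h f g n = trans (*≈conv (f S.+ g) h n) (trans (conv-+ˡ f g h n)
      (sym (+-cong (*≈conv f h n) (*≈conv g h n))))

  var-*-zero : ∀ f → (var rawRing S.* f) 0 ≈ 0#
  var-*-zero f = trans (*≈conv (var rawRing) f 0) (zeroˡ _)

  var-*-suc : ∀ f n → (var rawRing S.* f) (suc n) ≈ f n
  var-*-suc f n = trans (*≈conv (var rawRing) f (suc n))
    (trans (+-cong (zeroˡ _) (conv-cong var∘suc≈1 (λ _ → refl) n))
    (trans (+-identityˡ _) (trans (sym (*≈conv S.1# f n))
    (trans (const-* 1# f n) (*-identityˡ (f n))))))
    where
    var∘suc≈1 : ∀ k → var rawRing (suc k) ≈ S.1# k
    var∘suc≈1 zero    = refl
    var∘suc≈1 (suc _) = refl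

  -- d is a multiple of the variable, with invertible cofactor d ∘ suc.
  *-annihilate : ∀ {d} → d 0 ≈ 0# → d 1 ≈ 1# → ∀ {p} → (p S.* d) S.≈ S.0# → p S.≈ S.0#
  *-annihilate {d} d₀ d₁ {p} pd n = go n p λ k → begin
      conv p (d ∘ suc) k                        ≈⟨ +-identityˡ _ ⟨
      0# + conv p (d ∘ suc) k                   ≈⟨ +-congʳ (trans (*-congˡ d₀) (zeroʳ _)) ⟨
      p (suc k) * d 0 + conv p (d ∘ suc) k      ≈⟨ conv-sucʳ p d k ⟨
      conv p d (suc k)                          ≈⟨ *≈conv p d (suc k) ⟨
      (p S.* d) (suc k)                         ≈⟨ pd (suc k) ⟩
      0#                                        ∎
    where
    go : ∀ n p → (∀ k → conv p (d ∘ suc) k ≈ 0#) → p n ≈ 0#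
    go zero    p q = begin
      p 0           ≈⟨ *-identityʳ _ ⟨
      p 0 * 1#      ≈⟨ *-congˡ d₁ ⟨
      p 0 * d 1     ≈⟨ q 0 ⟩
      0#            ∎
    -- Once `p 0` is known to vanish, the hypothesis passes to `p ∘ suc`, so the coefficients are
    -- killed one at a time.
    go (suc n) p q = go n (p ∘ suc) λ k → begin
      conv (p ∘ suc) (d ∘ suc) k                      ≈⟨ +-identityˡ _ ⟨
      0# + conv (p ∘ suc) (d ∘ suc) k                 ≈⟨ +-congʳ (trans (*-congʳ (go zero p q)) (zeroˡ _)) ⟨
      p 0 * d (suc (suc k)) + conv (p ∘ suc) (d ∘ suc) k  ≈⟨ q (suc k) ⟩
      0#                                              ∎

-- Elimination of the auxiliary series and uniqueness of the quotient

module Elim {c ℓ} (R : CommutativeRing c ℓ) where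
  open CommutativeRing R
  open SetoidReasoning setoid
  open GroupProperties +-group using (∙-cancelˡ; ∙-cancelʳ; //-rightDividesˡ; //-rightDividesʳ)
  open RingProperties ring using ([y-z]x≈yx-zx)
  open SemiringSolver commutativeSemiring using (solve; con; _:=_; _:+_; _:*_)

  -- Since e (b - 1) = t f (b - 1) (e + T) = (b - 1 - t b) (e + T), we have t e b = T (b - 1 - t b).
  eliminate : ∀ t y T b e f →
    f ≈ b + y * e →
    b ≈ 1# + t * (b + f * (b - 1#)) →
    e ≈ t * (f * e + f * T) →
    (b - T * y * (b - 1# - t * b)) * (b - 1#) ≈ t * (b * (b * (b * 1#)))
  eliminate t y T b e f f≈ b≈ e≈ = begin
    (b - T * y * w) * d              ≈⟨ [y-z]x≈yx-zx d b (T * y * w) ⟩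
    b * d - T * y * w * d            ≈⟨ +-congʳ bd≈ ⟩
    t * (b * (b * (b * 1#))) + T * y * w * d - T * y * w * d ≈⟨ //-rightDividesʳ _ _ ⟩
    t * (b * (b * (b * 1#)))         ∎
    where
    d = b - 1#
    w = d - t * b
    d≈w+tb : d ≈ w + t * b
    d≈w+tb = sym (//-rightDividesˡ (t * b) d)
    1+d≈b : 1# + d ≈ b
    1+d≈b = trans (+-comm _ _) (//-rightDividesˡ 1# b)
    d≈ : d ≈ t * (b + f * d)
    d≈ = ∙-cancelˡ 1# _ _ (trans 1+d≈b b≈)
    w≈tfd : w ≈ t * f * d
    w≈tfd = ∙-cancelʳ (t * b) _ _ (begin
      w + t * b            ≈⟨ d≈w+tb ⟨
      d                    ≈⟨ d≈ ⟩
      t * (b + f * d)      ≈⟨ solve 4 (λ t b f d → t :* (b :+ f :* d) := t :* f :* d :+ t :* b) refl t b f d ⟩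
      t * f * d + t * b    ∎)
    Tw≈teb : T * w ≈ t * e * b
    -- Adding `w * e` produces the factor `e + T`, to which the equation for `e` applies. The term
    -- is cancelled additively, so nothing is divided by `d`.
    Tw≈teb = ∙-cancelˡ (w * e) _ _ (begin
      w * e + T * w        ≈⟨ solve 3 (λ w e T → w :* e :+ T :* w := w :* (e :+ T)) refl w e T ⟩
      w * (e + T)          ≈⟨ *-congʳ w≈tfd ⟩
      t * f * d * (e + T)  ≈⟨ solve 5 (λ t f d e T → t :* f :* d :* (e :+ T) := t :* (f :* e :+ f :* T) :* d) refl t f d e T ⟩
      t * (f * e + f * T) * d  ≈⟨ *-congʳ e≈ ⟨
      e * d                ≈⟨ *-congˡ d≈w+tb ⟩
      e * (w + t * b)      ≈⟨ solve 4 (λ t b w e → e :* (w :+ t :* b) := w :* e :+ t :* e :* b) refl t b w e ⟩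
      w * e + t * e * b    ∎)
    bd≈ : b * d ≈ t * (b * (b * (b * 1#))) + T * y * w * d
    bd≈ = begin
      b * d                              ≈⟨ *-congˡ d≈ ⟩
      b * (t * (b + f * d))              ≈⟨ *-congˡ (*-congˡ (+-congˡ (*-congʳ f≈))) ⟩
      -- The terms `b + b * d` combine to `b * (1# + d)`, which is the square of `b`; this is the
      -- origin of the cube.
      b * (t * (b + (b + y * e) * d))    ≈⟨ solve 5 (λ b t y e d →
                                              b :* (t :* (b :+ (b :+ y :* e) :* d)) :=
                                              t :* (b :* (b :* (con 1 :+ d))) :+ t :* e :* b :* y :* d)
                                              refl b t y e d ⟩
      t * (b * (b * (1# + d))) + t * e * b * y * d
        ≈⟨ +-cong (*-congˡ (*-congˡ (*-congˡ (trans 1+d≈b (sym (*-identityʳ b)))))) (*-congʳ (*-congʳ (sym Tw≈teb))) ⟩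
      t * (b * (b * (b * 1#))) + T * w * y * d
        ≈⟨ +-congˡ (*-congʳ (solve 3 (λ T w y → T :* w :* y := T :* y :* w) refl T w y)) ⟩
      t * (b * (b * (b * 1#))) + T * y * w * d ∎

module Quotient {c ℓ} (R : CommutativeRing c ℓ) where
  open CommutativeRing (Cauchy.series R)
  open GroupProperties +-group using (x∙y⁻¹≈ε⇒x≈y; x≈y⇒x∙y⁻¹≈ε)
  open RingProperties ring using ([y-z]x≈yx-zx)
  private module R = CommutativeRing R

  quotient-unique : ∀ {b f} → b 0 R.≈ R.1# → b 1 R.≈ R.1# →
                    ∀ q q′ → q * (b - 1#) ≈ f → q′ * (b - 1#) ≈ f → q′ ≈ q
  quotient-unique {b} {f} b₀ b₁ q q′ eq eq′ =
    x∙y⁻¹≈ε⇒x≈y q′ q (Cauchy.*-annihilate R {b - 1#} d₀ d₁ {q′ - q}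
      (trans ([y-z]x≈yx-zx (b - 1#) q′ q) (x≈y⇒x∙y⁻¹≈ε (trans eq′ (sym eq)))))
    where
    d₀ : (b - 1#) 0 R.≈ R.0#
    d₀ = R.trans (R.+-congʳ b₀) (R.-‿inverseʳ R.1#)
    d₁ : (b - 1#) 1 R.≈ R.1#
    d₁ = R.trans (R.+-cong b₁ (R.trans (R.sym (R.+-identityˡ _)) (R.-‿inverseʳ R.0#))) (R.+-identityʳ R.1#)

-- The equations for the series B, E and F.  A record type is compared by its parameters,
-- whereas comparing the equations themselves would unfold the generating functions.
record Recursive {c ℓ} (R : CommutativeRing c ℓ) (X : CommutativeRing.Carrier R) (k : ℕ)
                 (b e f : ℕ → CommutativeRing.Carrier R) : Set ℓ where
  private
    module R = CommutativeRing R
    module S = CommutativeRing (Cauchy.series R)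
  open SemiringExp S.semiring using () renaming (_^_ to _^ˢ_)
  field
    b-0 : b 0 R.≈ R.1#
    b-1 : b 1 R.≈ R.1#
    f≈ : f S.≈ b S.+ (const R.rawRing X S.- S.1#) S.* e
    b≈ : b S.≈ S.1# S.+ var R.rawRing S.* (b S.+ f S.* (b S.- S.1#))
    e≈ : e S.≈ var R.rawRing S.* (f S.* e S.+ f S.* var R.rawRing ^ˢ k)

module Combinatorics where

  open import Data.List.Membership.DecPropositional ℕₚ._≟_ using (_∈?_)
  open ℕₚ
  open ≡ using (refl; sym; trans)

  -- Lists with distinct entries, and counting

  module _ {a} {A : Set a} where

    -- The single occurrence of `v` on the right marks the split point. Applied with `v` the largest
    -- letter of a glued word, of `γ` or of `δ`.
    ++-cancel-∷ : ∀ {v : A} {us vs} → v ∉ us → v ∉ vs → ∀ xs {ys} →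
                  xs ++ v ∷ ys ≡ us ++ v ∷ vs → xs ≡ us × ys ≡ vs
    ++-cancel-∷ {us = []} _ _ [] refl = refl , refl
    ++-cancel-∷ {us = []} _ v∉vs (x ∷ xs) refl = contradiction (∈-++⁺ʳ xs (here refl)) v∉vs
    ++-cancel-∷ {us = u ∷ us} v∉us _ [] refl = contradiction (here refl) v∉us
    ++-cancel-∷ {us = u ∷ us} v∉us v∉vs (x ∷ xs) eq with refl , eq′ ← ∷-injective eq
      with refl , ys≡vs ← ++-cancel-∷ (v∉us ∘ there) v∉vs xs eq′ = refl , ys≡vs

    AllPairs-++⁻ : ∀ {r} {R : A → A → Set r} xs {ys} → AllPairs R (xs ++ ys) →
                   AllPairs R xs × AllPairs R ys × All (λ x → All (R x) ys) xs
    AllPairs-++⁻ []       p       = [] , p , []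
    AllPairs-++⁻ (x ∷ xs) (h ∷ p) with q₁ , q₂ , q₃ ← AllPairs-++⁻ xs p =
      Allₚ.++⁻ˡ xs h ∷ q₁ , q₂ , Allₚ.++⁻ʳ xs h ∷ q₃

    unique-⊆⇒length≤ : ∀ {xs ys : List A} → Unique xs → (∀ {v} → v ∈ xs → v ∈ ys) → length xs ≤ length ys
    unique-⊆⇒length≤ [] _ = z≤n
    unique-⊆⇒length≤ {x ∷ xs} (x∉ ∷ xs!) xs⊆ys with ps , qs , refl ← ∈-∃++ (xs⊆ys (here refl)) =
      ≤-trans (s≤s (unique-⊆⇒length≤ xs! λ v∈ → case ∈-++⁻ ps (xs⊆ys (there v∈)) of λ where
          (inj₁ v∈ps)         → ∈-++⁺ˡ v∈ps
          (inj₂ (here refl))  → contradiction refl (All.lookup x∉ v∈)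
          (inj₂ (there v∈qs)) → ∈-++⁺ʳ ps v∈qs))
        (≤-reflexive (sym (length-++-sucʳ ps x qs)))

    ⊆-++⁻ : ∀ {xs : List A} ys {zs} → xs ⊆ ys ++ zs →
            ∃₂ λ us vs → xs ≡ us ++ vs × us ⊆ ys × vs ⊆ zs
    ⊆-++⁻ []       p        = [] , _ , refl , [] , p
    ⊆-++⁻ (y ∷ ys) (_ ∷ʳ p) with us , vs , eq , q , r ← ⊆-++⁻ ys p = us , vs , eq , y ∷ʳ q , r
    ⊆-++⁻ (y ∷ ys) (x≡y ∷ p) with us , vs , eq , q , r ← ⊆-++⁻ ys p =
      _ ∷ us , vs , cong (_ ∷_) eq , x≡y ∷ q , r

    unique-map⁺ : ∀ {b} {B : Set b} (f : A → B) {xs} →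
                  (∀ {x y} → x ∈ xs → y ∈ xs → f x ≡ f y → x ≡ y) → Unique xs → Unique (map f xs)
    unique-map⁺ f inj []        = []
    unique-map⁺ f inj (x∉ ∷ xs!) =
      Allₚ.map⁺ (All.tabulate λ y∈ eq → All.lookup x∉ y∈ (inj (here refl) (there y∈) eq)) ∷
      unique-map⁺ f (λ p q → inj (there p) (there q)) xs!

  -- This bound yields the presence of the largest letter, the ranges of the two sides of it, and
  -- the ranks in a permutation.
  pigeonhole : ∀ lo k {w} → Unique w → All (λ a → lo < a × a ≤ lo ℕ.+ k) w → length w ≤ k
  pigeonhole lo k {w} w! w∈ = begin
    length w                                    ≤⟨ unique-⊆⇒length≤ w! (λ v∈ → let p , q = All.lookup w∈ v∈ in interval p q) ⟩
    length (applyUpTo (λ i → suc lo ℕ.+ i) k)   ≡⟨ length-applyUpTo (λ i → suc lo ℕ.+ i) k ⟩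
    k                                           ∎
    where
    open ≤-Reasoning
    interval : ∀ {v} → lo < v → v ≤ lo ℕ.+ k → v ∈ applyUpTo (λ i → suc lo ℕ.+ i) k
    interval {v} lo<v v≤ = subst (_∈ _) (m+[n∸m]≡n lo<v) (∈-applyUpTo⁺ _
      (+-cancelˡ-≤ lo _ _ (≤-trans (≤-reflexive (trans (+-suc lo _) (m+[n∸m]≡n lo<v))) v≤)))

  -- Avoidance of 132 around the largest letter

  infix 4 _≻_
  _≻_ : Word → Word → Set
  u ≻ v = All (λ a → All (_< a) v) u

  -- Avoidance of 132 in terms of order alone, free of `red`; `Av⁺` and `Av⁻` translate.
  Av : Word → Set
  Av σ = ∀ {a b c} → a ∷ c ∷ b ∷ [] ⊆ σ → a < b → b < c → ⊥

  -- The cases count how many letters of the occurrence lie in `u`. If one or two do, the first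
  -- letter is in `u` and the last in `n ∷ v`: a last letter in `v` is below the first, and `n` is
  -- too large to be the middle value. An occurrence cannot begin with `n` either.
  Av-glue : ∀ {n} u v → All (_< n) u → All (_< n) v → u ≻ v → Av u → Av v → Av (u ++ n ∷ v)
  Av-glue u v u<n v<n u≻v avu avv p a<b b<c with ⊆-++⁻ u p
  ... | [] , _ , refl , _ , (_ ∷ʳ q) = avv q a<b b<c
  ... | [] , _ , refl , _ , (refl ∷ q) =
    <-asym a<b (All.lookup v<n (Sub.Any-resp-⊆ q (there (here refl))))
  ... | _ ∷ [] , _ , refl , q , (_ ∷ʳ r) =
    <-asym a<b (All.lookup (All.lookup u≻v (Sub.Any-resp-⊆ q (here refl))) (Sub.Any-resp-⊆ r (there (here refl))))
  ... | _ ∷ [] , _ , refl , q , (refl ∷ r) =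
    <-asym a<b (All.lookup (All.lookup u≻v (Sub.Any-resp-⊆ q (here refl))) (Sub.Any-resp-⊆ r (here refl)))
  ... | _ ∷ _ ∷ [] , _ , refl , q , (refl ∷ r) =
    <-asym b<c (All.lookup u<n (Sub.Any-resp-⊆ q (there (here refl))))
  ... | _ ∷ _ ∷ [] , _ , refl , q , (_ ∷ʳ r) =
    <-asym a<b (All.lookup (All.lookup u≻v (Sub.Any-resp-⊆ q (here refl))) (Sub.Any-resp-⊆ r (here refl)))
  ... | _ ∷ _ ∷ _ ∷ [] , [] , refl , q , _ = avu q a<b b<c
  ... | _ ∷ _ ∷ _ ∷ _ ∷ _ , _ , () , _ , _

  -- A letter `a` of `u` below a letter `b` of `v` would form the forbidden `a n b`.
  Av⇒≻ : ∀ {n} u v → Unique (u ++ n ∷ v) → All (_< n) v → Av (u ++ n ∷ v) → u ≻ v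
  Av⇒≻ u v uv! v<n av with _ , _ , u≢v ← AllPairs-++⁻ u uv! =
    All.tabulate λ {a} a∈u → All.tabulate λ {b} b∈v → case <-cmp b a of λ where
      (tri< b<a _ _) → b<a
      (tri≈ _ b≡a _) → contradiction (sym b≡a) (All.lookup (All.lookup u≢v a∈u) (there b∈v))
      (tri> _ _ a<b) → ⊥-elim (av (Sub.++⁺ (from∈ a∈u) (refl ∷ from∈ b∈v)) a<b (All.lookup v<n b∈v))

  -- Ranks and reduction

  rank : Word → ℕ → ℕ
  rank w a = length (filter (_≤? a) w)

  rank-++ : ∀ u v a → rank (u ++ v) a ≡ rank u a ℕ.+ rank v a
  rank-++ u v a = trans (cong length (filter-++ (_≤? a) u v)) (length-++ (filter (_≤? a) u))

  rank-all : ∀ {w a} → All (_≤ a) w → rank w a ≡ length w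
  rank-all {a = a} w≤a = cong length (filter-all (_≤? a) w≤a)

  rank-none : ∀ {w a} → All (a <_) w → rank w a ≡ 0
  rank-none {a = a} a<w = cong length (filter-none (_≤? a) (All.map <⇒≱ a<w))

  red-++-≻ : ∀ u v → u ≻ v → red (u ++ v) ≡ map (length v ℕ.+_) (red u) ++ red v
  red-++-≻ u v u≻v = trans (map-++ (rank (u ++ v)) u v) (cong₂ _++_
    (trans (map-cong-local (All.map (λ {a} v<a → trans (rank-++ u v a)
        (trans (cong (rank u a ℕ.+_) (rank-all (All.map <⇒≤ v<a))) (+-comm (rank u a) _))) u≻v))
      (map-∘ u))
    (map-cong-local (All.tabulate λ {b} b∈v → trans (rank-++ u v b)
      (cong (ℕ._+ rank v b) (rank-none (All.map (λ v<a → All.lookup v<a b∈v) u≻v))))))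

  red-∷ʳ-max : ∀ {n} u → All (_< n) u → red (u ++ [ n ]) ≡ red u ++ [ suc (length u) ]
  red-∷ʳ-max {n} u u<n = trans (map-++ (rank (u ++ [ n ])) u [ n ]) (cong₂ (λ v b → v ++ [ b ])
    (map-cong-local (All.map (λ {a} a<n → trans (rank-++ u [ n ] a)
      (trans (cong (rank u a ℕ.+_) (rank-none (a<n ∷ []))) (+-identityʳ _))) u<n))
    (trans (rank-++ u [ n ] n) (trans (cong₂ ℕ._+_ (rank-all (All.map <⇒≤ u<n)) (rank-all {a = n} (≤-refl ∷ [])))
      (+-comm (length u) 1))))

  -- Just enough of the reduction to locate its largest letter; the other values stay unspecified.
  red-max : ∀ {n} u v → All (_< n) u → All (_< n) v →
            ∃₂ λ u′ v′ → length u′ ≡ length u × length v′ ≡ length v ×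
            red (u ++ n ∷ v) ≡ u′ ++ suc (length u ℕ.+ length v) ∷ v′
  red-max {n} u v u<n v<n = map r u , map r v , length-map r u , length-map r v ,
    trans (map-++ r u (n ∷ v)) (cong (λ b → map r u ++ b ∷ map r v)
      (trans (rank-all (Allₚ.++⁺ (All.map <⇒≤ u<n) (≤-refl ∷ All.map <⇒≤ v<n)))
        (trans (length-++ u) (+-suc (length u) (length v)))))
    where r = rank (u ++ n ∷ v)

  module _ {f : ℕ → ℕ} (f-mono : ∀ {a b} → a ≤ b → f a ≤ f b) (f-cancel : ∀ {a b} → f a ≤ f b → a ≤ b) where

    rank-map : ∀ w a → rank (map f w) (f a) ≡ rank w a
    rank-map []      a = refl
    rank-map (b ∷ w) a with b ≤? a
    ... | yes b≤a = trans (cong length (filter-accept (_≤? f a) (f-mono b≤a)))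
                      (trans (cong suc (rank-map w a)) (sym (cong length (filter-accept (_≤? a) b≤a))))
    ... | no  b≰a = trans (cong length (filter-reject (_≤? f a) (b≰a ∘ f-cancel)))
                      (trans (rank-map w a) (sym (cong length (filter-reject (_≤? a) b≰a))))

    red-map : ∀ w → red (map f w) ≡ red w
    red-map w = trans (sym (map-∘ w)) (map-cong (rank-map w) w)

  red-shift : ∀ j w → red (map (j ℕ.+_) w) ≡ red w
  red-shift j = red-map (+-monoʳ-≤ j) (+-cancelˡ-≤ j _ _)

  length-red : ∀ w → length (red w) ≡ length w
  length-red w = length-map _ w

  red-132⁺ : ∀ {a b c} → a < b → b < c → red (a ∷ c ∷ b ∷ []) ≡ 132-pattern
  red-132⁺ {a} {b} {c} a<b b<c = cong₂ _∷_ rank-a (cong₂ _∷_ rank-c (cong (_∷ []) rank-b))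
    where
    a<c = <-trans a<b b<c
    rank-a = trans (rank-++ [ a ] (c ∷ b ∷ []) a) (cong₂ ℕ._+_ (rank-all {a = a} (≤-refl ∷ [])) (rank-none (a<c ∷ a<b ∷ [])))
    rank-c = rank-all (<⇒≤ a<c ∷ ≤-refl ∷ <⇒≤ b<c ∷ [])
    rank-b = trans (rank-++ [ a ] (c ∷ b ∷ []) b) (cong₂ ℕ._+_ (rank-all (<⇒≤ a<b ∷ []))
      (trans (rank-++ [ c ] [ b ] b) (cong₂ ℕ._+_ (rank-none (b<c ∷ [])) (rank-all {a = b} (≤-refl ∷ [])))))

  red-132⁻ : ∀ w → red w ≡ 132-pattern → ∃ λ a → ∃₂ λ b c → w ≡ a ∷ c ∷ b ∷ [] × a < b × b < c
  red-132⁻ []                    ()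
  red-132⁻ (_ ∷ [])              ()
  red-132⁻ (_ ∷ _ ∷ [])          ()
  red-132⁻ (_ ∷ _ ∷ _ ∷ _ ∷ _)   ()
  red-132⁻ (a ∷ c ∷ b ∷ []) eq = a , b , c , refl , a<b , b<c
    where
    rank-∷∷∷ : ∀ d → rank (a ∷ c ∷ b ∷ []) d ≡ rank [ a ] d ℕ.+ (rank [ c ] d ℕ.+ rank [ b ] d)
    rank-∷∷∷ d = trans (rank-++ [ a ] (c ∷ b ∷ []) d) (cong (rank [ a ] d ℕ.+_) (rank-++ [ c ] [ b ] d))
    1≢1+k+1 : ∀ k → 1 ≢ 1 ℕ.+ (k ℕ.+ 1)
    1≢1+k+1 k eq = contradiction (suc-injective eq) (m<n⇒n≢0 {0} {k ℕ.+ 1} (m≤n+m 1 k) ∘ sym)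
    -- In the pattern `a` has rank 1, but if `b ≤ a` its rank counts both `a` and `b`. Likewise
    -- `c ≤ b` would give `b` rank 3 instead of 2.
    a<b : a < b
    a<b = ≰⇒> λ b≤a → 1≢1+k+1 _ (trans (sym (proj₁ (∷-injective eq))) (trans (rank-∷∷∷ a)
      (cong₂ (λ p q → p ℕ.+ (rank [ c ] a ℕ.+ q)) (rank-all {a = a} (≤-refl ∷ [])) (rank-all (b≤a ∷ [])))))
    b<c : b < c
    b<c = ≰⇒> λ c≤b → case trans (sym (proj₁ (∷-injective (∷-injectiveʳ (∷-injectiveʳ eq))))) (trans (rank-∷∷∷ b)
        (cong₂ ℕ._+_ (rank-all (<⇒≤ a<b ∷ [])) (cong₂ ℕ._+_ (rank-all (c≤b ∷ [])) (rank-all {a = b} (≤-refl ∷ []))))) of λ ()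

  -- Subsequences, and the enumeration of 132-avoiding permutations

  subsequences⁺ : ∀ {v w} → v ⊆ w → v ∈ subsequences w
  subsequences⁺ []         = here refl
  subsequences⁺ {w = a ∷ w} (a ∷ʳ p)   = ∈-++⁺ʳ (map (a ∷_) (subsequences w)) (subsequences⁺ p)
  subsequences⁺ (refl ∷ p) = ∈-++⁺ˡ (∈-map⁺ _ (subsequences⁺ p))

  subsequences⁻ : ∀ {v} w → v ∈ subsequences w → v ⊆ w
  subsequences⁻ []      (here refl) = []
  subsequences⁻ (a ∷ w) p with ∈-++⁻ (map (a ∷_) (subsequences w)) p
  ... | inj₂ q = a ∷ʳ subsequences⁻ w q
  ... | inj₁ q with _ , r , refl ← ∈-map⁻ (a ∷_) q = refl ∷ subsequences⁻ w r

  Av⁺ : ∀ {σ} → Avoids 132-pattern σ → Av σ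
  Av⁺ av p a<b b<c = All.lookup av (subsequences⁺ p) (red-132⁺ a<b b<c)

  Av⁻ : ∀ {σ} → Av σ → Avoids 132-pattern σ
  Av⁻ {σ} av = All.tabulate λ {w} w∈ eq → case red-132⁻ w eq of λ where
    (_ , _ , _ , refl , a<b , b<c) → av (subsequences⁻ σ w∈) a<b b<c

  subsequences-map : ∀ (f : ℕ → ℕ) w → subsequences (map f w) ≡ map (map f) (subsequences w)
  subsequences-map f []      = refl
  subsequences-map f (a ∷ w) rewrite subsequences-map f w = sym (trans
    (map-++ (map f) (map (a ∷_) (subsequences w)) (subsequences w))
    (cong (_++ map (map f) (subsequences w)) (trans (sym (map-∘ (subsequences w))) (map-∘ (subsequences w)))))

  module _ {p : Word} (j : ℕ) where

    Avoids-shift⁺ : ∀ w → Avoids p w → Avoids p (map (j ℕ.+_) w)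
    Avoids-shift⁺ w av = subst (All _) (sym (subsequences-map (j ℕ.+_) w))
      (Allₚ.map⁺ (All.map (λ {v} v≢p → v≢p ∘ trans (sym (red-shift j v))) av))

    Avoids-shift⁻ : ∀ w → Avoids p (map (j ℕ.+_) w) → Avoids p w
    Avoids-shift⁻ w av = All.map (λ {v} v≢p → v≢p ∘ trans (red-shift j v))
      (Allₚ.map⁻ (subst (All _) (subsequences-map (j ℕ.+_) w) av))

  words⁺ : ∀ {as} w → All (_∈ as) w → w ∈ words (length w) as
  words⁺ []      []         = here refl
  words⁺ (a ∷ w) (a∈ ∷ w∈)  = ∈-cartesianProductWith⁺ _∷_ a∈ (words⁺ w w∈)

  words⁻ : ∀ n {as w} → w ∈ words n as → length w ≡ n × All (_∈ as) w
  words⁻ zero    (here refl) = refl , []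
  words⁻ (suc n) {as} w∈ with _ , _ , a∈ , v∈ , refl ← ∈-cartesianProductWith⁻ _∷_ as (words n as) w∈
    with eq , v⊆ ← words⁻ n v∈ = cong suc eq , a∈ ∷ v⊆

  words-unique : ∀ n {as} → Unique as → Unique (words n as)
  words-unique zero    as! = [] ∷ []
  words-unique (suc n) as! = Uniqueₚ.cartesianProductWith⁺ _∷_ ∷-injective as! (words-unique n as!)

  record Perm132 (σ : Word) : Set where
    constructor perm132
    field
      range  : All (λ a → 0 < a × a ≤ length σ) σ
      unique : Unique σ
      avoids : Avoids 132-pattern σ

  open Perm132

  𝒮-unique : ∀ n → Unique (𝒮-avoiding 132-pattern n)
  𝒮-unique n = Uniqueₚ.filter⁺ (avoids? 132-pattern) (Uniqueₚ.filter⁺ _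
    (words-unique n (Uniqueₚ.map⁺ suc-injective (Uniqueₚ.upTo⁺ n))))

  ∈-𝒮⁺ : ∀ {σ} → Perm132 σ → σ ∈ 𝒮-avoiding 132-pattern (length σ)
  ∈-𝒮⁺ {σ} (perm132 r u av) = ∈-filter⁺ (avoids? 132-pattern) (∈-filter⁺ _ (words⁺ σ (All.map letter∈ r)) u) av
    where
    letter∈ : ∀ {a} → 0 < a × a ≤ length σ → a ∈ map suc (upTo (length σ))
    letter∈ {suc a} (_ , a<n) = ∈-map⁺ suc (∈-upTo⁺ a<n)

  ∈-𝒮⁻ : ∀ n {σ} → σ ∈ 𝒮-avoiding 132-pattern n → length σ ≡ n × Perm132 σ
  ∈-𝒮⁻ n {σ} σ∈ with σ∈′ , av ← ∈-filter⁻ (avoids? 132-pattern) σ∈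
    with σ∈″ , u ← ∈-filter⁻ _ σ∈′
    with refl , r ← words⁻ n {as = map suc (upTo n)} σ∈″ = refl , perm132 (All.map range∈ r) u av
    where
    range∈ : ∀ {a} → a ∈ map suc (upTo n) → 0 < a × a ≤ n
    range∈ a∈ with _ , i∈ , refl ← ∈-map⁻ suc a∈ = s≤s z≤n , ∈-upTo⁻ i∈

  -- Splitting a permutation at its largest letter

  -- The arguments are the reductions of the two sides of the largest letter, so each ranges freely
  -- over the 132-avoiding permutations.
  glue : Word → Word → Word
  glue A B = map (length B ℕ.+_) A ++ suc (length A ℕ.+ length B) ∷ B

  length-glue : ∀ A B → length (glue A B) ≡ suc (length A ℕ.+ length B)
  length-glue A B = trans (length-++ (map (length B ℕ.+_) A))
    (trans (cong (ℕ._+ suc (length B)) (length-map _ A)) (+-suc (length A) (length B)))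

  module _ {A B : Word} (pA : Perm132 A) (pB : Perm132 B) where
    private
      j = length B
      n = length A ℕ.+ j

    shift-range : All (λ a → j < a × a ≤ n) (map (j ℕ.+_) A)
    shift-range = Allₚ.map⁺ (All.map (λ {a} (0<a , a≤) →
        ≤-trans (≤-reflexive (+-comm 1 j)) (+-monoʳ-≤ j 0<a) ,
        ≤-trans (+-monoʳ-≤ j a≤) (≤-reflexive (+-comm j (length A))))
      (range pA))

    shift< : All (_< suc n) (map (j ℕ.+_) A)
    shift< = All.map (s≤s ∘ proj₂) shift-range

    right< : All (_< suc n) B
    right< = All.map (λ (_ , a≤j) → s≤s (≤-trans a≤j (m≤n+m j (length A)))) (range pB)

    shift≻ : map (j ℕ.+_) A ≻ B
    shift≻ = All.map (λ (j<a , _) → All.map (λ (_ , b≤j) → ≤-<-trans b≤j j<a) (range pB)) shift-range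

    glue-perm132 : Perm132 (glue A B)
    glue-perm132 = perm132
      (subst (λ l → All (λ a → 0 < a × a ≤ l) (glue A B)) (sym (length-glue A B)) (Allₚ.++⁺
        (All.map (λ (j<a , a≤n) → ≤-<-trans z≤n j<a , m≤n⇒m≤1+n a≤n) shift-range)
        ((s≤s z≤n , ≤-refl) ∷ All.zipWith (λ ((0<a , _) , a<1+n) → 0<a , <⇒≤ a<1+n) (range pB , right<))))
      (AllPairsₚ.++⁺ (Uniqueₚ.map⁺ (+-cancelˡ-≡ j _ _) (unique pA))
        (All.map (λ a< eq → <-irrefl (sym eq) a<) right< ∷ unique pB)
        (All.zipWith (λ (a< , B<a) → (λ eq → <-irrefl eq a<) ∷ All.map (λ b<a eq → <-irrefl (sym eq) b<a) B<a)
          (shift< , shift≻)))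
      (Av⁻ (Av-glue (map (j ℕ.+_) A) B shift< right< shift≻ (Av⁺ (Avoids-shift⁺ j A (avoids pA))) (Av⁺ (avoids pB))))

  -- Equal glued words have the same length, hence the same largest letter, and its position
  -- separates the two sides.
  glue-injective : ∀ {A A′ B B′} → Perm132 A → Perm132 B → Perm132 A′ → Perm132 B′ →
                   glue A B ≡ glue A′ B′ → A ≡ A′ × B ≡ B′
  glue-injective {A} {A′} {B} {B′} pA pB pA′ pB′ eq
    with eq₁ , refl ← ++-cancel-∷ {v = suc (length A′ ℕ.+ length B′)}
      (λ v∈ → <-irrefl refl (All.lookup (shift< pA′ pB′) v∈)) (λ v∈ → <-irrefl refl (All.lookup (right< pA′ pB′) v∈))
      (map (length B ℕ.+_) A) (trans (cong (λ v → map (length B ℕ.+_) A ++ v ∷ B)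
        (trans (sym (length-glue A′ B′)) (trans (cong length (sym eq)) (length-glue A B)))) eq)
    = map-injective (+-cancelˡ-≡ (length B) _ _) eq₁ , refl

  max∈ : ∀ {n σ} → length σ ≡ suc n → All (λ a → 0 < a × a ≤ suc n) σ → Unique σ → suc n ∈ σ
  max∈ {n} {σ} eq r u with suc n ∈? σ
  ... | yes p = p
  ... | no ∉σ = ⊥-elim (1+n≰n (≤-trans (≤-reflexive (sym eq)) (pigeonhole 0 n u
    (All.tabulate λ v∈ → let 0<v , v≤ = All.lookup r v∈ in
      0<v , ≤-pred (≤∧≢⇒< v≤ λ { refl → ∉σ v∈ })))))

  -- Counting forces the letters of each side. A letter of `A′` exceeds all `length B` distinct
  -- positive letters of `B`, hence exceeds `length B`. Conversely, all letters of `A′` lie between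
  -- a letter `b` of `B` and `n`, so `length A′` is at most `n ∸ b`, which bounds `b` by `length B`.
  unglue : ∀ {n σ} → length σ ≡ suc n → Perm132 σ →
           ∃₂ λ A B → Perm132 A × Perm132 B × length A ℕ.+ length B ≡ n × σ ≡ glue A B
  unglue {n} {σ} eq (perm132 r! u! av) with r ← subst (λ l → All (λ a → 0 < a × a ≤ l) σ) eq r!
    with A′ , B , refl ← ∈-∃++ (max∈ eq r u!)
    with uA , (N≢B ∷ uB) , A≢NB ← AllPairs-++⁻ A′ u!
    with rA , (_ ∷ rB) ← Allₚ.++⁻ A′ r = A , B ,
      perm132 A-range (Uniqueₚ.map⁻ (subst Unique A′≡ uA)) (Avoids-shift⁻ j A (subst (Avoids _) A′≡
        (Av⁻ {A′} λ p → Av⁺ av (Sub.++⁺ʳ (suc n ∷ B) p)))) ,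
      perm132 B-range uB (Av⁻ {B} λ p → Av⁺ av (Sub.++⁺ˡ A′ (suc n ∷ʳ p))) ,
      lengths , cong₂ (λ u l → u ++ suc l ∷ B) A′≡ (sym lengths)
    where
    j = length B
    A = map (_∸ j) A′
    lengths : length A ℕ.+ j ≡ n
    lengths = suc-injective (trans (sym (+-suc (length A) j)) (trans (cong (ℕ._+ suc j) (length-map _ A′))
      (trans (sym (length-++ A′)) eq)))
    A′≻B : A′ ≻ B
    A′≻B = Av⇒≻ A′ B u! (All.zipWith (λ ((_ , b≤) , N≢b) → ≤∧≢⇒< b≤ (N≢b ∘ sym)) (rB , N≢B)) (Av⁺ av)
    A′≤ : All (_≤ n) A′
    A′≤ = All.zipWith (λ { ((_ , a≤) , (a≢N ∷ _)) → ≤-pred (≤∧≢⇒< a≤ a≢N) }) (rA , A≢NB)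
    j<A′ : All (j <_) A′
    j<A′ = All.zipWith (λ { {suc a} ((_ , _) , B<a) → s≤s (pigeonhole 0 a uB
      (All.zipWith (λ ((0<b , _) , b<a) → 0<b , ≤-pred b<a) (rB , B<a))) }) (rA , A′≻B)
    A′≡ : A′ ≡ map (j ℕ.+_) A
    A′≡ = trans (sym (map-id-local (All.map (m+[n∸m]≡n ∘ <⇒≤) j<A′))) (map-∘ A′)
    A-range : All (λ a → 0 < a × a ≤ length A) A
    A-range = Allₚ.map⁺ (All.zipWith (λ {a} (j<a , a≤n) → m<n⇒0<n∸m j<a ,
      ≤-trans (∸-monoˡ-≤ j a≤n) (≤-reflexive (trans (cong (_∸ j) (sym lengths)) (m+n∸n≡m (length A) j)))) (j<A′ , A′≤))
    B-range : All (λ b → 0 < b × b ≤ j) B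
    B-range = All.tabulate λ {b} b∈ → let 0<b , b≤N = All.lookup rB b∈
                                          b≤n = ≤-pred (≤∧≢⇒< b≤N (All.lookup N≢B b∈ ∘ sym))
                                          A′-above = All.zipWith (λ (B<a , a≤n) →
                                            All.lookup B<a b∈ , ≤-trans a≤n (≤-reflexive (sym (m+[n∸m]≡n b≤n)))) (A′≻B , A′≤)
      in 0<b , +-cancelˡ-≤ (length A) _ _ (begin
        length A ℕ.+ b      ≡⟨ cong (ℕ._+ b) (length-map _ A′) ⟩
        length A′ ℕ.+ b     ≤⟨ +-monoˡ-≤ b (pigeonhole b (n ∸ b) uA A′-above) ⟩
        n ∸ b ℕ.+ b         ≡⟨ m∸n+n≡m b≤n ⟩
        n                   ≡⟨ lengths ⟨
        length A ℕ.+ j      ∎)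
      where open ≤-Reasoning

  module _ {a b c} {A : Set a} {B : Set b} {C : Set c} (f : A → B → C) where

    -- Injectivity is asked only on members of the lists, because `glue` is injective on
    -- permutations but not on all words.
    unique-cartesianProductWith⁺ : ∀ {xs ys} →
      (∀ {x x′ y y′} → x ∈ xs → y ∈ ys → x′ ∈ xs → y′ ∈ ys → f x y ≡ f x′ y′ → x ≡ x′ × y ≡ y′) →
      Unique xs → Unique ys → Unique (cartesianProductWith f xs ys)
    unique-cartesianProductWith⁺ inj [] ys! = []
    unique-cartesianProductWith⁺ {x ∷ xs} {ys} inj (x∉ ∷ xs!) ys! = Uniqueₚ.++⁺
      (unique-map⁺ (f x) (λ p q → proj₂ ∘ inj (here refl) p (here refl) q) ys!)
      (unique-cartesianProductWith⁺ (λ p q p′ q′ → inj (there p) q (there p′) q′) xs! ys!)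
      λ (v∈ , v∈′) → case ∈-map⁻ (f x) v∈ , ∈-cartesianProductWith⁻ f xs ys v∈′ of λ where
        ((_ , y∈ , refl) , (_ , _ , x′∈ , y′∈ , eq)) →
          All.lookup x∉ x′∈ (proj₁ (inj (here refl) y∈ (there x′∈) y′∈ eq))

  𝒮132 : ℕ → List Word
  𝒮132 = 𝒮-avoiding 132-pattern

  glued : ℕ → ℕ → List Word
  glued n i = cartesianProductWith glue (𝒮132 i) (𝒮132 (n ∸ i))

  -- Duplicate-free lists with the same members agree up to order. Different blocks are disjoint
  -- because `glue-injective` recovers the left part, and its length is the block index.
  𝒮132-suc : ∀ n → 𝒮132 (suc n) ↭ concatMap (glued n) (upTo (suc n))
  𝒮132-suc n = ∼bag⇒↭ (unique∧set⇒bag (𝒮-unique (suc n)) glued-unique (mk⇔ to from))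
    where
    glued-unique-at : ∀ i → Unique (glued n i)
    glued-unique-at i = unique-cartesianProductWith⁺ glue
      (λ p q p′ q′ → glue-injective (proj₂ (∈-𝒮⁻ i p)) (proj₂ (∈-𝒮⁻ (n ∸ i) q))
                                    (proj₂ (∈-𝒮⁻ i p′)) (proj₂ (∈-𝒮⁻ (n ∸ i) q′)))
      (𝒮-unique i) (𝒮-unique (n ∸ i))
    glued-unique : Unique (concatMap (glued n) (upTo (suc n)))
    glued-unique = Uniqueₚ.concat⁺ {xss = map (glued n) (upTo (suc n))}
      (Allₚ.map⁺ (All.universal glued-unique-at (upTo (suc n))))
      (AllPairsₚ.map⁺ {f = glued n} (AllPairs.map (λ {i} {i′} i≢i′ {v} (v∈ , v∈′) →
        case ∈-cartesianProductWith⁻ glue (𝒮132 i) (𝒮132 (n ∸ i)) v∈ ,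
             ∈-cartesianProductWith⁻ glue (𝒮132 i′) (𝒮132 (n ∸ i′)) v∈′ of λ where
          ((A , B , A∈ , B∈ , refl) , (A′ , B′ , A′∈ , B′∈ , eq)) → i≢i′ (disjoint {j = n ∸ i} {n ∸ i′} A∈ B∈ A′∈ B′∈ eq))
        (Uniqueₚ.upTo⁺ (suc n))))
      where
      disjoint : ∀ {i i′ j j′ A B A′ B′} → A ∈ 𝒮132 i → B ∈ 𝒮132 j → A′ ∈ 𝒮132 i′ → B′ ∈ 𝒮132 j′ →
                 glue A B ≡ glue A′ B′ → i ≡ i′
      disjoint {i} {i′} {j} {j′} A∈ B∈ A′∈ B′∈ eq
        with refl , pA ← ∈-𝒮⁻ i A∈ | refl , pA′ ← ∈-𝒮⁻ i′ A′∈
        = cong length (proj₁ (glue-injective pA (proj₂ (∈-𝒮⁻ j B∈)) pA′ (proj₂ (∈-𝒮⁻ j′ B′∈)) eq))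
    to : ∀ {σ} → σ ∈ 𝒮132 (suc n) → σ ∈ concatMap (glued n) (upTo (suc n))
    to σ∈ with eq , pσ ← ∈-𝒮⁻ (suc n) σ∈ with A , B , pA , pB , refl , refl ← unglue eq pσ =
      ∈-concat⁺′ (∈-cartesianProductWith⁺ glue (∈-𝒮⁺ pA)
        (subst (λ j → B ∈ 𝒮132 j) (sym (m+n∸m≡n (length A) (length B))) (∈-𝒮⁺ pB)))
        (∈-map⁺ (glued n) (∈-upTo⁺ (s≤s (m≤m+n (length A) (length B)))))
    from : ∀ {σ} → σ ∈ concatMap (glued n) (upTo (suc n)) → σ ∈ 𝒮132 (suc n)
    from σ∈ with xs , σ∈xs , xs∈ ← ∈-concat⁻′ (map (glued n) (upTo (suc n))) σ∈
      with i , i∈ , refl ← ∈-map⁻ (glued n) xs∈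
      with A , B , A∈ , B∈ , refl ← ∈-cartesianProductWith⁻ glue (𝒮132 i) (𝒮132 (n ∸ i)) σ∈xs
      with refl , pA ← ∈-𝒮⁻ i A∈ | eq , pB ← ∈-𝒮⁻ (n ∸ i) B∈
      = subst (λ l → glue A B ∈ 𝒮132 l)
          (trans (length-glue A B) (cong suc (trans (cong (i ℕ.+_) eq) (m+[n∸m]≡n (≤-pred (∈-upTo⁻ i∈))))))
          (∈-𝒮⁺ (glue-perm132 pA pB))

  length-filter-∁ : ∀ {a p} {A : Set a} {P : Pred A p} (P? : Decidable P) xs →
                    length (filter P? xs) ℕ.+ length (filter (¬? ∘ P?) xs) ≡ length xs
  length-filter-∁ P? []       = refl
  length-filter-∁ P? (x ∷ xs) with P? x
  ... | yes _ = cong suc (length-filter-∁ P? xs)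
  ... | no  _ = trans (+-suc _ _) (cong suc (length-filter-∁ P? xs))

  -- At most `a` letters are `≤ a` and at most `length σ ∸ a` are larger; as together they make up
  -- `σ`, both bounds are attained.
  red-perm132 : ∀ {σ} → Perm132 σ → red σ ≡ σ
  red-perm132 {σ} (perm132 r u _) = map-id-local (All.tabulate λ {a} a∈ → rank≡ (proj₂ (All.lookup r a∈)))
    where
    rank≡ : ∀ {a} → a ≤ length σ → rank σ a ≡ a
    rank≡ {a} a≤n = ≤-antisym
      (pigeonhole 0 a (Uniqueₚ.filter⁺ (_≤? a) u)
        (All.zip (Allₚ.filter⁺ (_≤? a) (All.map proj₁ r) , Allₚ.all-filter (_≤? a) σ)))
      (+-cancelʳ-≤ (length σ ∸ a) _ _ (begin
        a ℕ.+ (length σ ∸ a)             ≡⟨ m+[n∸m]≡n a≤n ⟩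
        length σ                         ≡⟨ length-filter-∁ (_≤? a) σ ⟨
        rank σ a ℕ.+ length (filter (¬? ∘ (_≤? a)) σ)
          ≤⟨ +-monoʳ-≤ (rank σ a) (pigeonhole a (length σ ∸ a) (Uniqueₚ.filter⁺ _ u)
               (All.zipWith (λ ((_ , b≤n) , b≰a) → ≰⇒> b≰a , ≤-trans b≤n (≤-reflexive (sym (m+[n∸m]≡n a≤n))))
                 (Allₚ.filter⁺ (¬? ∘ (_≤? a)) r , Allₚ.all-filter (¬? ∘ (_≤? a)) σ))) ⟩
        rank σ a ℕ.+ (length σ ∸ a)      ∎))
      where open ≤-Reasoning

  -- Counting occurrences over suffixes

  ind : ∀ {p} {P : Set p} → Dec P → ℕ
  ind P? = if does P? then 1 else 0

  module _ {p} {P : Set p} (P? : Dec P) where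

    ind-yes : P → ind P? ≡ 1
    ind-yes p = cong (if_then 1 else 0) (dec-true P? p)

    ind-no : ¬ P → ind P? ≡ 0
    ind-no ¬p = cong (if_then 1 else 0) (dec-false P? ¬p)

  ind-cong : ∀ {p q} {P : Set p} {Q : Set q} (P? : Dec P) (Q? : Dec Q) → (P → Q) → (Q → P) → ind P? ≡ ind Q?
  ind-cong P? (yes q) f g = ind-yes P? (g q)
  ind-cong P? (no ¬q) f g = ind-no P? (¬q ∘ f)

  module _ {a} {A : Set a} where

    take-++-≤ : ∀ {n} (u v : List A) → n ≤ length u → take n (u ++ v) ≡ take n u
    take-++-≤ {zero}  u       v _        = refl
    take-++-≤ {suc n} (x ∷ u) v (s≤s n≤) = cong (x ∷_) (take-++-≤ u v n≤)

    take-++-+ : ∀ (u : List A) {v} n → take (length u ℕ.+ n) (u ++ v) ≡ u ++ take n v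
    take-++-+ []      n = refl
    take-++-+ (x ∷ u) n = cong (x ∷_) (take-++-+ u n)

  module _ {p} {P : Pred Word p} (P? : Decidable P) where

    -- Common form of `mch γ`, where `P` looks at an initial window of each suffix, and of `ends`,
    -- where `P` looks at the whole suffix.
    occ : Word → ℕ
    occ w = length (filter P? (tails w))

    occ-∷ : ∀ a w → occ (a ∷ w) ≡ ind (P? (a ∷ w)) ℕ.+ occ w
    occ-∷ a w with does (P? (a ∷ w))
    ... | true  = refl
    ... | false = refl

    occ-short : ∀ {l} → (∀ {w} → P w → l ≤ length w) → ∀ w → length w < l → occ w ≡ 0
    occ-short l≤ [] 0<l = cong length (filter-none P? ((λ p → <⇒≱ 0<l (l≤ p)) ∷ []))
    occ-short l≤ (a ∷ w) w<l = trans (occ-∷ a w)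
      (cong₂ ℕ._+_ (ind-no (P? (a ∷ w)) (λ p → <⇒≱ w<l (l≤ p))) (occ-short l≤ w (<⇒≤ w<l)))

    occ-map : ∀ {f} → (∀ w → P (map f w) → P w) → (∀ w → P w → P (map f w)) → ∀ w → occ (map f w) ≡ occ w
    occ-map to from [] with does (P? [])
    ... | true  = refl
    ... | false = refl
    occ-map {f} to from (a ∷ w) = trans (occ-∷ (f a) (map f w)) (trans
      (cong₂ ℕ._+_ (ind-cong (P? (map f (a ∷ w))) (P? (a ∷ w)) (to (a ∷ w)) (from (a ∷ w))) (occ-map to from w))
      (sym (occ-∷ a w)))

  red-∷-max : ∀ {n} v → All (_< n) v → red (n ∷ v) ≡ suc (length v) ∷ red v
  red-∷-max {n} v v<n = trans (red-++-≻ [ n ] v (v<n ∷ []))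
    (cong (_∷ red v) (trans (cong (length v ℕ.+_) (rank-all {[ n ]} (≤-refl ∷ []))) (+-comm (length v) 1)))

  red-∷ʳ-max-∷ʳ-min : ∀ {n b} u → All (_< n) u → b < n → All (b <_) u →
    red (u ++ n ∷ b ∷ []) ≡ map suc (red u) ++ suc (suc (length u)) ∷ 1 ∷ []
  red-∷ʳ-max-∷ʳ-min {n} {b} u u<n b<n b<u = begin
    red (u ++ n ∷ b ∷ [])                              ≡⟨ cong red (++-assoc u [ n ] [ b ]) ⟨
    red ((u ++ [ n ]) ++ [ b ])                        ≡⟨ red-++-≻ (u ++ [ n ]) [ b ] (Allₚ.++⁺ (All.map (_∷ []) b<u) ((b<n ∷ []) ∷ [])) ⟩
    map suc (red (u ++ [ n ])) ++ red [ b ]            ≡⟨ cong₂ (λ s t → map suc s ++ t ∷ []) (red-∷ʳ-max u u<n) (rank-all {[ b ]} (≤-refl ∷ [])) ⟩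
    map suc (red u ++ [ suc (length u) ]) ++ [ 1 ]     ≡⟨ cong (_++ [ 1 ]) (map-++ suc (red u) _) ⟩
    (map suc (red u) ++ [ suc (suc (length u)) ]) ++ [ 1 ] ≡⟨ ++-assoc (map suc (red u)) _ _ ⟩
    map suc (red u) ++ suc (suc (length u)) ∷ 1 ∷ []   ∎
    where open ≡.≡-Reasoning

  -- A match containing `n` needs one letter after `n`; written as a number, this condition can
  -- multiply `ends`.
  nonempty : Word → ℕ
  nonempty []      = 0
  nonempty (_ ∷ _) = 1

  -- Matches of `γ` and endings in `δ` across the largest letter

  module Pattern (τ : Word) (τ-range : All (_≤ length τ) τ) (0<∣τ∣ : 0 < length τ) where

    -- For `γ` of length m this is m - 3, the exponent of `t` in the recursion.
    k : ℕ
    k = length τ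

    δ γ : Word
    δ = suc k ∷ τ
    γ = map suc δ ++ suc (suc (suc k)) ∷ 1 ∷ []

    length-γ : length γ ≡ suc (suc (suc k))
    length-γ = trans (length-++ (map suc δ)) (trans (cong (ℕ._+ 2) (length-map suc δ)) (+-comm (suc k) 2))

    max∉δ : suc (suc (suc k)) ∉ map suc δ
    max∉δ m∈ with _ , a∈ , refl ← ∈-map⁻ suc m∈ =
      1+n≰n (All.lookup {P = _≤ suc k} (≤-refl ∷ All.map m≤n⇒m≤1+n τ-range) a∈)

    max∉[1] : suc (suc (suc k)) ∉ [ 1 ]
    max∉[1] (here ())

    end? : Decidable (λ w → red w ≡ δ)
    end? w = red w ≟ʷ δ

    -- At most one suffix has the length of `δ`, so this is 0 or 1. Defining it as a count gives it
    -- the same recursion over starting points as `mch γ`.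
    ends : Word → ℕ
    ends = occ end?

    δ-length : ∀ w → red w ≡ δ → length w ≡ suc k
    δ-length w eq = trans (sym (length-red w)) (cong length eq)

    match? : Decidable (λ w → red (take (length γ) w) ≡ γ)
    match? w = red (take (length γ) w) ≟ʷ γ

    match-length : ∀ {w} → red (take (length γ) w) ≡ γ → length γ ≤ length w
    match-length {w} eq = begin
      length γ                       ≡⟨ cong length eq ⟨
      length (red (take (length γ) w)) ≡⟨ length-red (take (length γ) w) ⟩
      length (take (length γ) w)     ≡⟨ length-take (length γ) w ⟩
      length γ ℕ.⊓ length w          ≤⟨ m⊓n≤n (length γ) (length w) ⟩
      length w                       ∎
      where open ≤-Reasoning

    module _ {n : ℕ} where

      red≡γ⁺ : ∀ {b} u → All (_< n) u → b < n → All (b <_) u → red u ≡ δ → red (u ++ n ∷ b ∷ []) ≡ γ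
      red≡γ⁺ u u<n b<n b<u eq = trans (red-∷ʳ-max-∷ʳ-min u u<n b<n b<u)
        (cong₂ (λ s l → map suc s ++ suc (suc l) ∷ 1 ∷ []) eq (δ-length u eq))

      red≡γ⇒length : ∀ u v → red (u ++ n ∷ v) ≡ γ → suc (suc (suc k)) ≡ suc (length u ℕ.+ length v)
      red≡γ⇒length u v eq = trans (sym length-γ) (trans (cong length (sym eq)) (trans (length-red (u ++ n ∷ v))
        (trans (length-++ u) (+-suc (length u) (length v)))))

      -- The largest value of `γ` occurs once, so it sits at the place of `n` and exactly one letter
      -- follows. That letter is below all of `u`, so the form of the reduction is known and a
      -- second cancellation compares `u` with `δ`.
      red≡γ⁻ : ∀ u v → All (_< n) u → All (_< n) v → u ≻ v → red (u ++ n ∷ v) ≡ γ → red u ≡ δ × length v ≡ 1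
      red≡γ⁻ u v u<n v<n u≻v eq
        with u′ , v′ , _ , lv , eq′ ← red-max u v u<n v<n
        with _ , refl ← ++-cancel-∷ max∉δ max∉[1] u′ (trans (cong (λ a → u′ ++ a ∷ v′) (red≡γ⇒length u v eq)) (trans (sym eq′) eq))
        with b ∷ [] ← v | b<n ∷ [] ← v<n
        = map-injective suc-injective (proj₁ (++-cancel-∷ max∉δ max∉[1] (map suc (red u))
            (trans (cong (λ a → map suc (red u) ++ a ∷ 1 ∷ []) (trans (red≡γ⇒length u (b ∷ []) eq) (cong suc (+-comm (length u) 1))))
              (trans (sym (red-∷ʳ-max-∷ʳ-min u u<n b<n (All.map All.head u≻v))) eq)))) , refl

      -- Only the window at the first position is considered. It either stays inside `u` or reaches
      -- `n`, and in the latter case it matches only if `u` reduces to `δ`. Such a `u` is too short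
      -- to contain a match, so the two summands are never both 1.
      ind-match-++ : ∀ u v → All (_< n) u → All (_< n) v → u ≻ v →
        ind (match? (u ++ n ∷ v)) ≡ ind (match? u) ℕ.+ ind (end? u) ℕ.* nonempty v
      ind-match-++ u v u<n v<n u≻v with end? u
      ind-match-++ u v u<n v<n u≻v | no ¬δ = trans (ind-cong (match? (u ++ n ∷ v)) (match? u) to from) (sym (+-identityʳ _))
        where
        from : red (take (length γ) u) ≡ γ → red (take (length γ) (u ++ n ∷ v)) ≡ γ
        from eq = trans (cong red (take-++-≤ u (n ∷ v) (match-length {u} eq))) eq
        to : red (take (length γ) (u ++ n ∷ v)) ≡ γ → red (take (length γ) u) ≡ γ
        to eq with length γ ≤? length u
        ... | yes ≤u = trans (cong red (sym (take-++-≤ u (n ∷ v) ≤u))) eq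
        -- Here `d` is the length of the part of the window beyond `n`.
        ... | no  ≰u with d , d≡ ← m≤n⇒∃[o]m+o≡n (≰⇒> ≰u) = contradiction
            (proj₁ (red≡γ⁻ u (take d v) u<n (Allₚ.take⁺ d v<n) (All.map (Allₚ.take⁺ d) u≻v)
              (trans (cong red (trans (sym (take-++-+ u (suc d))) (cong (λ l → take l (u ++ n ∷ v)) (trans (+-suc (length u) d) d≡)))) eq)))
            ¬δ
      ind-match-++ u [] u<n v<n u≻v | yes eq = trans (ind-no (match? (u ++ n ∷ [])) (short ∘ match-length {u ++ n ∷ []}))
        (sym (cong (ℕ._+ 0) (ind-no (match? u) λ p → short (≤-trans (match-length {u} p) (≤-trans (m≤m+n _ 1) (≤-reflexive (sym (length-++ u))))))))
        where
        short : ¬ length γ ≤ length (u ++ n ∷ [])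
        short γ≤ = 1+n≰n (begin
          suc (suc (suc k))        ≡⟨ length-γ ⟨
          length γ                 ≤⟨ γ≤ ⟩
          length (u ++ n ∷ [])     ≡⟨ length-++ u ⟩
          length u ℕ.+ 1           ≡⟨ cong (ℕ._+ 1) (δ-length u eq) ⟩
          suc k ℕ.+ 1              ≡⟨ +-comm (suc k) 1 ⟩
          suc (suc k)              ∎)
          where open ≤-Reasoning
      ind-match-++ u (b ∷ v) u<n (b<n ∷ _) u≻v | yes eq = trans
        (ind-yes (match? (u ++ n ∷ b ∷ v)) (trans (cong red (trans (cong (λ l → take l (u ++ n ∷ b ∷ v)) length≡) (take-++-+ u 2)))
          (red≡γ⁺ u u<n b<n (All.map All.head u≻v) eq)))
        (sym (cong (ℕ._+ 1) (ind-no (match? u) λ p → m+1+n≰m (length u) (≤-trans (≤-reflexive (sym length≡)) (match-length {u} p)))))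
        where
        length≡ : length γ ≡ length u ℕ.+ 2
        length≡ = trans length-γ (trans (+-comm 2 (suc k)) (cong (ℕ._+ 2) (sym (δ-length u eq))))

      -- The sum of `ind-match-++` over the starting points in `u`; its instance with empty `u`
      -- excludes a match that starts at `n`.
      mch-++ : ∀ u v → All (_< n) u → All (_< n) v → u ≻ v →
        mch γ (u ++ n ∷ v) ≡ mch γ u ℕ.+ ends u ℕ.* nonempty v ℕ.+ mch γ v
      mch-++ []      v u<n v<n u≻v = trans (occ-∷ match? n v) (cong (ℕ._+ mch γ v) (ind-match-++ [] v u<n v<n u≻v))
      mch-++ (a ∷ u) v a∷u<n@(a<n ∷ u<n) v<n a∷u≻v@(v<a ∷ u≻v) = begin
        mch γ (a ∷ u ++ n ∷ v)
          ≡⟨ occ-∷ match? a (u ++ n ∷ v) ⟩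
        ind (match? (a ∷ u ++ n ∷ v)) ℕ.+ mch γ (u ++ n ∷ v)
          ≡⟨ cong₂ ℕ._+_ (ind-match-++ (a ∷ u) v a∷u<n v<n a∷u≻v) (mch-++ u v u<n v<n u≻v) ⟩
        (i₁ ℕ.+ i₂ ℕ.* c) ℕ.+ (mch γ u ℕ.+ ends u ℕ.* c ℕ.+ mch γ v)
          ≡⟨ solve 6 (λ i₁ i₂ c m e m′ → (i₁ :+ i₂ :* c) :+ (m :+ e :* c :+ m′) := (i₁ :+ m) :+ (i₂ :+ e) :* c :+ m′)
               refl i₁ i₂ c (mch γ u) (ends u) (mch γ v) ⟩
        (i₁ ℕ.+ mch γ u) ℕ.+ (i₂ ℕ.+ ends u) ℕ.* c ℕ.+ mch γ v
          ≡⟨ cong₂ (λ p q → p ℕ.+ q ℕ.* c ℕ.+ mch γ v) (occ-∷ match? a u) (occ-∷ end? a u) ⟨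
        mch γ (a ∷ u) ℕ.+ ends (a ∷ u) ℕ.* c ℕ.+ mch γ v ∎
        where
        open ≡.≡-Reasoning
        open +-*-Solver
        i₁ = ind (match? (a ∷ u))
        i₂ = ind (end? (a ∷ u))
        c  = nonempty v

      -- `δ` begins with its largest value, so a suffix that starts inside `u` and contains `n`
      -- later cannot reduce to it. The suffix starting at `n` does so exactly when `v` reduces to
      -- `τ`.
      ends-++ : ∀ u v → All (_< n) u → All (_< n) v → ends (u ++ n ∷ v) ≡ ind (red v ≟ʷ τ) ℕ.+ ends v
      ends-++ []      v [] v<n = trans (occ-∷ end? n v) (cong (ℕ._+ ends v)
        (ind-cong (end? (n ∷ v)) (red v ≟ʷ τ)
          (λ eq → ∷-injectiveʳ (trans (sym (red-∷-max v v<n)) eq))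
          (λ eq → trans (red-∷-max v v<n) (cong₂ (λ l w → suc l ∷ w) (trans (sym (length-red v)) (cong length eq)) eq))))
      ends-++ (a ∷ u) v a∷u<n@(a<n ∷ u<n) v<n = trans (occ-∷ end? a (u ++ n ∷ v))
        (cong₂ ℕ._+_ (ind-no (end? (a ∷ u ++ n ∷ v)) red≢δ) (ends-++ u v u<n v<n))
        where
        red≢δ : red (a ∷ u ++ n ∷ v) ≢ δ
        red≢δ eq with red-max (a ∷ u) v a∷u<n v<n
        ... | u′ , v′ , lu , _ , eq′ with ++-cancel-∷ {us = []} {vs = τ} (λ ()) (λ k∈ → 1+n≰n (All.lookup τ-range k∈)) u′
               (trans (cong (λ l → u′ ++ l ∷ v′)
                  (trans (sym (δ-length (a ∷ u ++ n ∷ v) eq)) (trans (length-++ (a ∷ u)) (+-suc (length (a ∷ u)) (length v))))) (trans (sym eq′) eq))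
        ... | refl , _ = case lu of λ ()

    mch-shift : ∀ j w → mch γ (map (j ℕ.+_) w) ≡ mch γ w
    mch-shift j = occ-map match? (λ w → trans (sym (red-take w))) (λ w → trans (red-take w))
      where
      red-take : ∀ w → red (take (length γ) (map (j ℕ.+_) w)) ≡ red (take (length γ) w)
      red-take w = trans (cong red (take-map (length γ) w)) (red-shift j (take (length γ) w))

    ends-shift : ∀ j w → ends (map (j ℕ.+_) w) ≡ ends w
    ends-shift j = occ-map end? (λ w → trans (sym (red-shift j w))) (λ w → trans (red-shift j w))

    mch-glue : ∀ {A B} → Perm132 A → Perm132 B →
               mch γ (glue A B) ≡ mch γ A ℕ.+ ends A ℕ.* nonempty B ℕ.+ mch γ B
    mch-glue {A} {B} pA pB = trans (mch-++ _ B (shift< pA pB) (right< pA pB) (shift≻ pA pB))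
      (cong₂ (λ p q → p ℕ.+ q ℕ.* nonempty B ℕ.+ mch γ B) (mch-shift (length B) A) (ends-shift (length B) A))

    ends-glue : ∀ {A B} → Perm132 A → Perm132 B → ends (glue A B) ≡ ind (red B ≟ʷ τ) ℕ.+ ends B
    ends-glue {A} {B} pA pB = ends-++ _ B (shift< pA pB) (right< pA pB)

    ends≤1 : ∀ w → ends w ≡ 0 ⊎ ends w ≡ 1
    ends≤1 []      = inj₁ refl
    ends≤1 (a ∷ w) with end? (a ∷ w)
    ... | yes eq = inj₂ (trans (occ-∷ end? a w) (cong₂ ℕ._+_ (ind-yes (end? (a ∷ w)) eq)
                     (occ-short end? (λ {v} → ≤-reflexive ∘ sym ∘ δ-length v) w (≤-reflexive (δ-length (a ∷ w) eq)))))
    ... | no ¬eq with ends≤1 w | trans (occ-∷ end? a w) (cong (ℕ._+ ends w) (ind-no (end? (a ∷ w)) ¬eq))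
    ...   | inj₁ p | q = inj₁ (trans q p)
    ...   | inj₂ p | q = inj₂ (trans q p)

    mch-τ : ∀ {w} → red w ≡ τ → mch γ w ≡ 0
    mch-τ {w} eq = occ-short match? (λ {v} → match-length {v}) w
      (≤-trans (s≤s (≤-reflexive (trans (sym (length-red w)) (cong length eq)))) (≤-trans (m≤n+m _ 2) (≤-reflexive (sym length-γ))))

  -- The shape of `γ`

  head-drop-∈ : ∀ i {w : Word} {a} → head (drop i w) ≡ just a → a ∈ w
  head-drop-∈ zero    {_ ∷ _} refl = here refl
  head-drop-∈ (suc i) {_ ∷ _} eq   = there (head-drop-∈ i eq)

  head-drop-max : ∀ {n} i u v → All (_< n) u → All (_< n) v → head (drop i (u ++ n ∷ v)) ≡ just n → i ≡ length u
  head-drop-max zero    []      v _ _ _ = refl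
  head-drop-max (suc i) []      v _ v<n eq = contradiction refl (ℕₚ.<⇒≢ (All.lookup v<n (head-drop-∈ i eq)))
  head-drop-max zero    (a ∷ u) v (a<n ∷ _) _ refl = contradiction refl (ℕₚ.<⇒≢ a<n)
  head-drop-max (suc i) (a ∷ u) v (_ ∷ u<n) v<n eq = cong suc (head-drop-max i u v u<n v<n eq)

  perm132-one : ∀ {B} → length B ≡ 1 → Perm132 B → B ≡ 1 ∷ []
  perm132-one {suc zero ∷ []}    refl _ = refl
  perm132-one {zero ∷ []}        refl (perm132 ((() , _) ∷ _) _ _)
  perm132-one {suc (suc _) ∷ []} refl (perm132 ((_ , s≤s ()) ∷ _) _ _)

  -- The position of m leaves a single letter to its right, which must be 1 in a glued word. The
  -- left part then begins with its own largest letter, so splitting it again leaves nothing on the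
  -- left and `τ` on the right.
  γ-form : ∀ m → 1 ≤ m → m ≢ 3 → ∀ γ → γ ∈ 𝒮-avoiding 132-pattern m →
    letter γ 1 ≡ just (m ∸ 1) → letter γ (m ∸ 1) ≡ just m →
    ∃ λ τ → Perm132 τ × 0 < length τ × m ≡ suc (suc (suc (length τ))) ×
      γ ≡ map suc (suc (length τ) ∷ τ) ++ suc (suc (suc (length τ))) ∷ 1 ∷ []
  -- For m = 1 the letter with number 0 is `nothing`; for m = 2 the first letter would have to be
  -- both 1 and 2.
  γ-form 1 _ _ γ _ _ ()
  γ-form 2 _ _ γ _ l₁ l₂ with trans (sym l₁) l₂
  ... | ()
  γ-form (suc (suc (suc n))) _ m≢3 γ γ∈ l₁ l₂
    with len , pγ ← ∈-𝒮⁻ (suc (suc (suc n))) γ∈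
    with A , B , pA , pB , A+B≡ , refl ← unglue len pγ
    with 1+n≡A ← trans (head-drop-max (suc n) (map (length B ℕ.+_) A) B (shift< pA pB) (right< pA pB)
           (trans l₂ (cong (just ∘ suc) (sym A+B≡)))) (length-map _ A)
    with refl ← perm132-one (ℕₚ.+-cancelˡ-≡ (suc n) (length B) 1
           (trans (cong (ℕ._+ length B) 1+n≡A) (trans A+B≡ (ℕₚ.+-comm 1 (suc n))))) pB
    with unglue (sym 1+n≡A) pA
  -- The condition on the first letter of `γ` makes it the largest letter of `A`, but with a
  -- nonempty left part the first letter of `A` is smaller.
  ... | c ∷ C , D , pC , pD , C+D≡ , refl = contradiction
    (ℕₚ.suc-injective (just-injective (trans l₁ (cong (just ∘ suc ∘ suc) (sym C+D≡)))))
    (ℕₚ.<⇒≢ (All.head (shift< pC pD)))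
  ... | [] , τ , _ , pτ , refl , refl =
    τ , pτ , ℕₚ.n≢0⇒n>0 (m≢3 ∘ cong (suc ∘ suc ∘ suc)) , refl ,
    cong (λ l → map suc (suc (length τ) ∷ τ) ++ suc l ∷ 1 ∷ []) (ℕₚ.+-comm (suc (length τ)) 1)


open Combinatorics

-- Finite sums and generating functions of statistics

module Sums {c ℓ} (R : CommutativeRing c ℓ) where
  open CommutativeRing R hiding (zero)
  open SetoidReasoning setoid
  open CommutativeSemigroupProperties +-commutativeSemigroup using (interchange; x∙yz≈y∙xz)

  module _ {a} {A : Set a} where

    Σ : (A → Carrier) → List A → Carrier
    Σ f xs = ∑ rawRing (map f xs)

    Σ-cong : ∀ {f g xs} → All (λ x → f x ≈ g x) xs → Σ f xs ≈ Σ g xs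
    Σ-cong []       = refl
    Σ-cong (p ∷ ps) = +-cong p (Σ-cong ps)

    Σ-zero : ∀ {f xs} → All (λ x → f x ≈ 0#) xs → Σ f xs ≈ 0#
    Σ-zero []       = refl
    Σ-zero (p ∷ ps) = trans (+-cong p (Σ-zero ps)) (+-identityˡ 0#)

    Σ-+ : ∀ f g xs → Σ (λ x → f x + g x) xs ≈ Σ f xs + Σ g xs
    Σ-+ f g []       = sym (+-identityˡ 0#)
    Σ-+ f g (x ∷ xs) = trans (+-congˡ (Σ-+ f g xs)) (interchange _ _ _ _)

    Σ-*ˡ : ∀ r f xs → Σ (λ x → r * f x) xs ≈ r * Σ f xs
    Σ-*ˡ r f []       = sym (zeroʳ r)
    Σ-*ˡ r f (x ∷ xs) = trans (+-congˡ (Σ-*ˡ r f xs)) (sym (distribˡ r _ _))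

    Σ-*ʳ : ∀ r f xs → Σ (λ x → f x * r) xs ≈ Σ f xs * r
    Σ-*ʳ r f []       = sym (zeroˡ r)
    Σ-*ʳ r f (x ∷ xs) = trans (+-congˡ (Σ-*ʳ r f xs)) (sym (distribʳ r _ _))

    Σ-++ : ∀ f xs ys → Σ f (xs ++ ys) ≈ Σ f xs + Σ f ys
    Σ-++ f []       ys = sym (+-identityˡ _)
    Σ-++ f (x ∷ xs) ys = trans (+-congˡ (Σ-++ f xs ys)) (sym (+-assoc _ _ _))

    Σ-↭ : ∀ f {xs ys} → xs ↭ ys → Σ f xs ≈ Σ f ys
    Σ-↭ f Perm.refl          = refl
    Σ-↭ f (Perm.prep x p)    = +-congˡ (Σ-↭ f p)
    Σ-↭ f (Perm.swap x y p)  = trans (x∙yz≈y∙xz _ _ _) (+-congˡ (+-congˡ (Σ-↭ f p)))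
    Σ-↭ f (Perm.trans p q)   = trans (Σ-↭ f p) (Σ-↭ f q)

    Σ-single : ∀ f {v xs} → Unique xs → v ∈ xs → (∀ {x} → x ≢ v → f x ≈ 0#) → Σ f xs ≈ f v
    Σ-single f (v∉ ∷ _) (here ≡.refl) f≈0 =
      trans (+-congˡ (Σ-zero (All.map (λ v≢x → f≈0 (v≢x ∘ ≡.sym)) v∉))) (+-identityʳ _)
    Σ-single f (x∉ ∷ xs!) (there v∈) f≈0 =
      trans (+-cong (f≈0 (All.lookup x∉ v∈)) (Σ-single f xs! v∈ f≈0)) (+-identityˡ _)

  module _ {a b} {A : Set a} {B : Set b} where

    Σ-concatMap : ∀ f (g : A → List B) xs → Σ f (concatMap g xs) ≈ Σ (λ x → Σ f (g x)) xs
    Σ-concatMap f g []       = refl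
    Σ-concatMap f g (x ∷ xs) = trans (Σ-++ f (g x) (concatMap g xs)) (+-congˡ (Σ-concatMap f g xs))

    Σ-* : ∀ (f : A → Carrier) (g : B → Carrier) xs ys →
          Σ (λ x → Σ (λ y → f x * g y) ys) xs ≈ Σ f xs * Σ g ys
    Σ-* f g xs ys = trans (Σ-cong (All.universal (λ x → Σ-*ˡ (f x) g ys) xs)) (Σ-*ʳ (Σ g ys) f xs)

    Σ-cartesianProductWith : ∀ {d} {D : Set d} (f : D → Carrier) (g : A → B → D) xs ys →
      Σ f (cartesianProductWith g xs ys) ≈ Σ (λ x → Σ (λ y → f (g x y)) ys) xs
    Σ-cartesianProductWith f g []       ys = refl
    Σ-cartesianProductWith f g (x ∷ xs) ys = trans (Σ-++ f (map (g x) ys) _)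
      (+-cong (reflexive (cong (∑ rawRing) (≡.sym (map-∘ ys)))) (Σ-cartesianProductWith f g xs ys))

  gf : (Word → Carrier) → ℕ → Carrier
  gf f n = Σ f (𝒮132 n)

  perms : ∀ n → All (λ σ → length σ ≡ n × Perm132 σ) (𝒮132 n)
  perms n = All.tabulate (∈-𝒮⁻ n)

  private module S = CommutativeRing (Cauchy.series R)

  -- The blocks `glued n i` are indexed exactly like the terms of a Cauchy product. Two products are
  -- provided because each functional equation distinguishes two kinds of right part.
  gf-glue : ∀ {φ f₁ g₁ f₂ g₂} →
    (∀ {A B} → Perm132 A → Perm132 B → φ (glue A B) ≈ f₁ A * g₁ B + f₂ A * g₂ B) →
    ∀ n → gf φ (suc n) ≈ (gf f₁ S.* gf g₁ S.+ gf f₂ S.* gf g₂) n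
  gf-glue {φ} {f₁} {g₁} {f₂} {g₂} φ-glue n = begin
    Σ φ (𝒮132 (suc n))                                      ≈⟨ Σ-↭ φ (𝒮132-suc n) ⟩
    Σ φ (concatMap (glued n) (upTo (suc n)))                ≈⟨ Σ-concatMap φ (glued n) (upTo (suc n)) ⟩
    Σ (λ i → Σ φ (glued n i)) (upTo (suc n))                ≈⟨ Σ-cong (All.universal Σ-glued (upTo (suc n))) ⟩
    Σ (λ i → gf f₁ i * gf g₁ (n ∸ i) + gf f₂ i * gf g₂ (n ∸ i)) (upTo (suc n))
                                                            ≈⟨ Σ-+ _ _ (upTo (suc n)) ⟩
    (gf f₁ S.* gf g₁ S.+ gf f₂ S.* gf g₂) n                 ∎
    where
    Σ-glued : ∀ i → Σ φ (glued n i) ≈ gf f₁ i * gf g₁ (n ∸ i) + gf f₂ i * gf g₂ (n ∸ i)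
    Σ-glued i = begin
      Σ φ (glued n i)
        ≈⟨ Σ-cartesianProductWith φ glue (𝒮132 i) (𝒮132 (n ∸ i)) ⟩
      Σ (λ A → Σ (λ B → φ (glue A B)) (𝒮132 (n ∸ i))) (𝒮132 i)
        ≈⟨ Σ-cong (All.map (λ (_ , pA) → Σ-cong (All.map (λ (_ , pB) → φ-glue pA pB) (perms (n ∸ i)))) (perms i)) ⟩
      Σ (λ A → Σ (λ B → f₁ A * g₁ B + f₂ A * g₂ B) (𝒮132 (n ∸ i))) (𝒮132 i)
        ≈⟨ Σ-cong (All.universal (λ A → Σ-+ (λ B → f₁ A * g₁ B) (λ B → f₂ A * g₂ B) (𝒮132 (n ∸ i))) (𝒮132 i)) ⟩
      Σ (λ A → Σ (λ B → f₁ A * g₁ B) (𝒮132 (n ∸ i)) + Σ (λ B → f₂ A * g₂ B) (𝒮132 (n ∸ i))) (𝒮132 i)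
        ≈⟨ Σ-+ _ _ (𝒮132 i) ⟩
      Σ (λ A → Σ (λ B → f₁ A * g₁ B) (𝒮132 (n ∸ i))) (𝒮132 i) + Σ (λ A → Σ (λ B → f₂ A * g₂ B) (𝒮132 (n ∸ i))) (𝒮132 i)
        ≈⟨ +-cong (Σ-* f₁ g₁ (𝒮132 i) (𝒮132 (n ∸ i))) (Σ-* f₂ g₂ (𝒮132 i) (𝒮132 (n ∸ i))) ⟩
      gf f₁ i * gf g₁ (n ∸ i) + gf f₂ i * gf g₂ (n ∸ i) ∎

  -- The functional equations for the three generating functions

  module Recursion (τ : Word) (τ-perm : Perm132 τ) (0<∣τ∣ : 0 < length τ) (X : Carrier) where
    open Pattern τ (All.map proj₂ (Perm132.range τ-perm)) 0<∣τ∣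
    open Cauchy R using (const-*; var-*-zero; var-*-suc)
    open SemiringMult semiring using (×-homo-+) renaming (_×_ to _×ᴿ_)
    open SemiringExp semiring using (_^_; ^-homo-*)
    open SemiringExp S.semiring using () renaming (_^_ to _^ˢ_)
    open GroupProperties +-group using () renaming (//-rightDividesˡ to [x-y]+y≈x)

    fromℕ : ℕ → Carrier
    fromℕ n = n ×ᴿ 1#

    fromℕ-0 : ∀ {n} → n ≡ 0 → fromℕ n ≈ 0#
    fromℕ-0 ≡.refl = refl

    fromℕ-1 : ∀ {n} → n ≡ 1 → fromℕ n ≈ 1#
    fromℕ-1 ≡.refl = +-identityʳ 1#

    -- `weight⁺` includes the match that is completed once a new largest letter and a nonempty lower
    -- word follow. `[ε]` and `weight-ε` select empty and nonempty right parts.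
    weight weight⁺ weightᵉ isτ [ε] weight-ε : Word → Carrier
    weight σ  = X ^ mch γ σ
    weight⁺ σ = X ^ (mch γ σ ℕ.+ ends σ)
    weightᵉ σ = weight σ * fromℕ (ends σ)
    isτ σ     = fromℕ (ind (red σ ≟ʷ τ))
    [ε] []      = 1#
    [ε] (_ ∷ _) = 0#
    weight-ε []        = 0#
    weight-ε σ@(_ ∷ _) = weight σ

    b f e : S.Carrier
    b = gf weight
    f = gf weight⁺
    e = gf weightᵉ

    mch-short : ∀ w → length w < 3 → mch γ w ≡ 0
    mch-short w w<3 = occ-short match? (λ {v} p → subst (_≤ length v) length-γ (match-length {v} p)) w
      (ℕₚ.≤-trans w<3 (s≤s (s≤s (s≤s z≤n))))

    weight-short : ∀ w → length w < 3 → weight w ≈ 1#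
    weight-short w w<3 = reflexive (cong (X ^_) (mch-short w w<3))

    b-0 : b 0 ≈ 1#
    b-0 = trans (+-identityʳ _) (weight-short [] (s≤s z≤n))

    b-1 : b 1 ≈ 1#
    b-1 = trans (+-identityʳ _) (weight-short (1 ∷ []) (s≤s (s≤s z≤n)))

    gf-[ε] : gf [ε] S.≈ S.1#
    gf-[ε] zero    = +-identityʳ 1#
    gf-[ε] (suc n) = Σ-zero (All.map (λ { {_ ∷ _} _ → refl }) (perms (suc n)))

    gf-weight-ε : gf weight-ε S.≈ b S.- S.1#
    gf-weight-ε zero    = trans (+-identityʳ 0#) (sym (trans (+-congʳ b-0) (-‿inverseʳ 1#)))
    gf-weight-ε (suc n) = trans (Σ-cong (All.map (λ { {_ ∷ _} _ → refl }) (perms (suc n))))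
      (sym (trans (+-congˡ (trans (sym (+-identityˡ _)) (-‿inverseʳ 0#))) (+-identityʳ _)))

    weight-glue : ∀ {A B} → Perm132 A → Perm132 B → weight (glue A B) ≈ weight A * [ε] B + weight⁺ A * weight-ε B
    weight-glue {A} {B} pA pB = trans (reflexive (cong (X ^_) (mch-glue pA pB))) (split B)
      where
      split : ∀ B → X ^ (mch γ A ℕ.+ ends A ℕ.* nonempty B ℕ.+ mch γ B) ≈ weight A * [ε] B + weight⁺ A * weight-ε B
      split [] = begin
        X ^ (mch γ A ℕ.+ ends A ℕ.* 0 ℕ.+ mch γ [])  ≡⟨ cong (X ^_) (cong₂ (λ p q → mch γ A ℕ.+ p ℕ.+ q) (ℕₚ.*-zeroʳ (ends A)) (mch-short [] (s≤s z≤n))) ⟩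
        X ^ (mch γ A ℕ.+ 0 ℕ.+ 0)                    ≡⟨ cong (X ^_) (≡.trans (ℕₚ.+-identityʳ (mch γ A ℕ.+ 0)) (ℕₚ.+-identityʳ (mch γ A))) ⟩
        weight A                                     ≈⟨ trans (sym (*-identityʳ _)) (sym (+-identityʳ _)) ⟩
        weight A * 1# + 0#                           ≈⟨ +-congˡ (zeroʳ _) ⟨
        weight A * 1# + weight⁺ A * 0#               ∎
      split (a ∷ B) = begin
        X ^ (mch γ A ℕ.+ ends A ℕ.* 1 ℕ.+ mch γ (a ∷ B))  ≡⟨ cong (λ p → X ^ (mch γ A ℕ.+ p ℕ.+ mch γ (a ∷ B))) (ℕₚ.*-identityʳ (ends A)) ⟩
        X ^ (mch γ A ℕ.+ ends A ℕ.+ mch γ (a ∷ B))        ≈⟨ ^-homo-* X (mch γ A ℕ.+ ends A) _ ⟩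
        weight⁺ A * weight (a ∷ B)                        ≈⟨ +-identityˡ _ ⟨
        0# + weight⁺ A * weight (a ∷ B)                   ≈⟨ +-congʳ (zeroʳ _) ⟨
        weight A * 0# + weight⁺ A * weight (a ∷ B)        ∎

    -- The same factor `weight⁺ A` serves both summands, since a right part that ends in `δ` or
    -- reduces to `τ` is nonempty. In the second summand the right part has weight 1, because a copy
    -- of `τ` contains no match.
    weightᵉ-glue : ∀ {A B} → Perm132 A → Perm132 B → weightᵉ (glue A B) ≈ weight⁺ A * weightᵉ B + weight⁺ A * isτ B
    weightᵉ-glue {A} {B} pA pB =
      trans (*-cong (reflexive (cong (X ^_) (mch-glue pA pB))) (reflexive (cong fromℕ (ends-glue pA pB)))) (split B)
      where
      isτ-weight : ∀ B → weight B * isτ B ≈ isτ B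
      isτ-weight B with red B ≟ʷ τ
      ... | yes eq = trans (*-congʳ (reflexive (cong (X ^_) (mch-τ {B} eq)))) (*-identityˡ _)
      ... | no ¬eq = zeroʳ _
      split : ∀ B → X ^ (mch γ A ℕ.+ ends A ℕ.* nonempty B ℕ.+ mch γ B) * fromℕ (ind (red B ≟ʷ τ) ℕ.+ ends B) ≈
              weight⁺ A * weightᵉ B + weight⁺ A * isτ B
      -- Both sides vanish because `τ` is nonempty. For empty `τ` the left side would be `weight A`,
      -- the right side `weight⁺ A`.
      split [] = trans (trans (*-congˡ (fromℕ-0 (≡.trans (ℕₚ.+-identityʳ _) not-τ))) (zeroʳ _))
        (sym (trans (+-cong (trans (*-congˡ (zeroʳ _)) (zeroʳ _)) (trans (*-congˡ (fromℕ-0 not-τ)) (zeroʳ _))) (+-identityˡ 0#)))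
        where
        not-τ : ind (red [] ≟ʷ τ) ≡ 0
        not-τ = ind-no (red [] ≟ʷ τ) λ eq → ℕₚ.<-irrefl (cong length eq) 0<∣τ∣
      split B@(a ∷ B′) = begin
        X ^ (mch γ A ℕ.+ ends A ℕ.* 1 ℕ.+ mch γ B) * fromℕ (ind (red B ≟ʷ τ) ℕ.+ ends B)
          ≡⟨ cong (λ p → X ^ (mch γ A ℕ.+ p ℕ.+ mch γ B) * fromℕ (ind (red B ≟ʷ τ) ℕ.+ ends B)) (ℕₚ.*-identityʳ (ends A)) ⟩
        X ^ (mch γ A ℕ.+ ends A ℕ.+ mch γ B) * fromℕ (ind (red B ≟ʷ τ) ℕ.+ ends B)
          ≈⟨ *-cong (^-homo-* X (mch γ A ℕ.+ ends A) _) (×-homo-+ 1# (ind (red B ≟ʷ τ)) (ends B)) ⟩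
        weight⁺ A * weight B * (isτ B + fromℕ (ends B))
          ≈⟨ trans (*-assoc _ _ _) (*-congˡ (trans (distribˡ _ _ _) (+-comm _ _))) ⟩
        weight⁺ A * (weightᵉ B + weight B * isτ B)
          ≈⟨ trans (*-congˡ (+-congˡ (isτ-weight B))) (distribˡ _ _ _) ⟩
        weight⁺ A * weightᵉ B + weight⁺ A * isτ B ∎

    -- For an exponent i equal to 0 or 1, the power of `X` is 1 + (`X` - 1) i; apply this to
    -- `ends σ`.
    f≈b+ye : f S.≈ b S.+ (const rawRing X S.- S.1#) S.* e
    f≈b+ye n = begin
      gf weight⁺ n                                      ≈⟨ Σ-cong (All.universal split (𝒮132 n)) ⟩
      Σ (λ σ → weight σ + (X - 1#) * weightᵉ σ) (𝒮132 n) ≈⟨ Σ-+ weight (λ σ → (X - 1#) * weightᵉ σ) (𝒮132 n) ⟩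
      b n + Σ (λ σ → (X - 1#) * weightᵉ σ) (𝒮132 n)     ≈⟨ +-congˡ (Σ-*ˡ (X - 1#) weightᵉ (𝒮132 n)) ⟩
      b n + (X - 1#) * e n                              ≈⟨ +-congˡ (const-* (X - 1#) e n) ⟨
      b n + (const rawRing (X - 1#) S.* e) n            ≈⟨ +-congˡ (S.*-congʳ {x = e} const- n) ⟩
      b n + ((const rawRing X S.- S.1#) S.* e) n        ∎
      where
      const- : const rawRing (X - 1#) S.≈ const rawRing X S.- S.1#
      const- zero    = refl
      const- (suc _) = sym (-‿inverseʳ 0#)
      split : ∀ σ → weight⁺ σ ≈ weight σ + (X - 1#) * weightᵉ σ
      split σ with ends≤1 σ
      ... | inj₁ eq = begin
        weight⁺ σ                        ≡⟨ cong (λ p → X ^ (mch γ σ ℕ.+ p)) eq ⟩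
        X ^ (mch γ σ ℕ.+ 0)              ≡⟨ cong (X ^_) (ℕₚ.+-identityʳ (mch γ σ)) ⟩
        weight σ                         ≈⟨ +-identityʳ _ ⟨
        weight σ + 0#                    ≈⟨ +-congˡ (trans (*-congˡ (trans (*-congˡ (fromℕ-0 eq)) (zeroʳ _))) (zeroʳ _)) ⟨
        weight σ + (X - 1#) * weightᵉ σ  ∎
      ... | inj₂ eq = begin
        weight⁺ σ                        ≡⟨ cong (λ p → X ^ (mch γ σ ℕ.+ p)) eq ⟩
        X ^ (mch γ σ ℕ.+ 1)              ≡⟨ cong (X ^_) (ℕₚ.+-comm (mch γ σ) 1) ⟩
        X * weight σ                     ≈⟨ *-congʳ (trans (sym ([x-y]+y≈x 1# X)) (+-comm _ _)) ⟩
        (1# + (X - 1#)) * weight σ       ≈⟨ trans (distribʳ _ _ _) (+-congʳ (*-identityˡ _)) ⟩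
        weight σ + (X - 1#) * weight σ   ≈⟨ +-congˡ (*-congˡ (trans (*-congˡ (fromℕ-1 eq)) (*-identityʳ _))) ⟨
        weight σ + (X - 1#) * weightᵉ σ  ∎

    b≈ : b S.≈ S.1# S.+ var rawRing S.* (b S.+ f S.* (b S.- S.1#))
    b≈ zero    = trans b-0 (sym (trans (+-congˡ (var-*-zero (b S.+ f S.* (b S.- S.1#)))) (+-identityʳ _)))
    b≈ (suc n) = begin
      b (suc n)
        ≈⟨ gf-glue weight-glue n ⟩
      (b S.* gf [ε] S.+ f S.* gf weight-ε) n
        ≈⟨ S.+-cong (S.trans {b S.* gf [ε]} {b S.* S.1#} {b} (S.*-congˡ {b} gf-[ε]) (S.*-identityʳ b)) (S.*-congˡ {f} gf-weight-ε) n ⟩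
      (b S.+ f S.* (b S.- S.1#)) n
        ≈⟨ var-*-suc (b S.+ f S.* (b S.- S.1#)) n ⟨
      (var rawRing S.* (b S.+ f S.* (b S.- S.1#))) (suc n)
        ≈⟨ +-identityˡ _ ⟨
      0# + (var rawRing S.* (b S.+ f S.* (b S.- S.1#))) (suc n) ∎

    var-^ : ∀ j n → (var rawRing ^ˢ j) n ≈ fromℕ (ind (n ℕₚ.≟ j))
    var-^ zero    zero    = sym (+-identityʳ _)
    var-^ zero    (suc n) = refl
    var-^ (suc j) zero    = var-*-zero (var rawRing ^ˢ j)
    var-^ (suc j) (suc n) = trans (var-*-suc (var rawRing ^ˢ j) n) (var-^ j n)

    -- Permutations are their own reductions, so `τ` alone contributes, in degree `k`.
    gf-isτ : gf isτ S.≈ var rawRing ^ˢ k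
    gf-isτ n with n ℕₚ.≟ k
    ... | no n≢k = trans
      (Σ-zero (All.map (λ {σ} (len , _) → fromℕ-0 (ind-no (red σ ≟ʷ τ) λ eq →
        n≢k (≡.trans (≡.sym len) (≡.trans (≡.sym (length-red σ)) (cong length eq))))) (perms n)))
      (sym (trans (var-^ k n) (fromℕ-0 (ind-no (n ℕₚ.≟ k) n≢k))))
    ... | yes ≡.refl = begin
      gf isτ k
        ≈⟨ Σ-cong (All.map (λ {σ} (_ , pσ) → reflexive (cong (λ w → fromℕ (ind (w ≟ʷ τ))) (red-perm132 pσ))) (perms k)) ⟩
      Σ (λ σ → fromℕ (ind (σ ≟ʷ τ))) (𝒮132 k)
        ≈⟨ Σ-single _ (𝒮-unique k) (∈-𝒮⁺ τ-perm) (λ {σ} σ≢τ → fromℕ-0 (ind-no (σ ≟ʷ τ) σ≢τ)) ⟩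
      fromℕ (ind (τ ≟ʷ τ))
        ≡⟨ cong fromℕ (≡.trans (ind-yes (τ ≟ʷ τ) ≡.refl) (≡.sym (ind-yes (k ℕₚ.≟ k) ≡.refl))) ⟩
      fromℕ (ind (k ℕₚ.≟ k))
        ≈⟨ var-^ k k ⟨
      (var rawRing ^ˢ k) k ∎

    e≈ : e S.≈ var rawRing S.* (f S.* e S.+ f S.* var rawRing ^ˢ k)
    e≈ zero    = trans (trans (+-identityʳ _) (zeroʳ _)) (sym (var-*-zero (f S.* e S.+ f S.* var rawRing ^ˢ k)))
    e≈ (suc n) = begin
      e (suc n)                                 ≈⟨ gf-glue weightᵉ-glue n ⟩
      (f S.* e S.+ f S.* gf isτ) n              ≈⟨ +-congˡ (S.*-congˡ {f} gf-isτ n) ⟩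
      (f S.* e S.+ f S.* var rawRing ^ˢ k) n    ≈⟨ var-*-suc (f S.* e S.+ f S.* var rawRing ^ˢ k) n ⟨
      (var rawRing S.* (f S.* e S.+ f S.* var rawRing ^ˢ k)) (suc n) ∎

    recursive : Recursive R X k b e f
    recursive = record { b-0 = b-0 ; b-1 = b-1 ; f≈ = f≈b+ye ; b≈ = b≈ ; e≈ = e≈ }

open import Defs

-- The quotient and the recursion over the integers

private
  module ℤ⟦x⟧ = CommutativeRing (Cauchy.series +-*-commutativeRing)

solution : ∀ k {β e f : Carrier} → Recursive (Cauchy.series +-*-commutativeRing) (var +-*-rawRing) k β e f →
  ∃ λ Q → IsQuotient (t * β ^ 3) (β - 1#) Q × β ≈ Q + t ^ k * (x - 1#) * (β - 1# - t * β)
solution k {β} {e} {f} rec = q , (q-* , λ q′ → unique q q′ q-*) , λ n → ℤ⟦x⟧.sym (//-rightDividesˡ (z n) (β n))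
  where
  open Recursive rec
  open GroupProperties ℤ⟦x⟧.+-group using (//-rightDividesˡ)
  z q : Carrier
  z = t ^ k * (x - 1#) * (β - 1# - t * β)
  -- The quotient is taken to be what the recursion requires, so the recursion is immediate and the
  -- elimination only has to verify the product with `β - 1#`.
  q = β - z
  q-* : q * (β - 1#) ≈ t * β ^ 3
  q-* = Elim.eliminate (Cauchy.series (Cauchy.series +-*-commutativeRing)) t (x - 1#) (t ^ k) β e f f≈ b≈ e≈
  unique : ∀ q q′ → q * (β - 1#) ≈ t * β ^ 3 → q′ * (β - 1#) ≈ t * β ^ 3 → q′ ≈ q
  unique q q′ = Quotient.quotient-unique (Cauchy.series +-*-commutativeRing) {β} {t * β ^ 3} b-0 b-1 q q′

B-recursive : ∀ {m γ} → 1 ≤ m → m ≢ 3 → γ ∈ 𝒮-avoiding 132-pattern m →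
  letter γ 1 ≡ just (m ∸ 1) → letter γ (m ∸ 1) ≡ just m →
  ∃₂ λ e f → Recursive (Cauchy.series +-*-commutativeRing) (var +-*-rawRing) (m ∸ 3) (B γ) e f
B-recursive {m} {γ} 1≤m m≢3 γ∈ l₁ l₂ with _ , pτ , 0<τ , ≡.refl , ≡.refl ← γ-form m 1≤m m≢3 γ γ∈ l₁ l₂ =
  e , f , recursive
  where open Sums.Recursion (Cauchy.series +-*-commutativeRing) _ pτ 0<τ (var +-*-rawRing)

theorem17 : (m : ℕ) → 1 ≤ m → m ≢ 3 →
    (γ : Word) → γ ∈ 𝒮-avoiding 132-pattern m →
    letter γ 1 ≡ just (m ∸ 1) →
    letter γ (m ∸ 1) ≡ just m →
    letter γ m ≡ just 1 →
    ∃ λ Q → IsQuotient (t * B γ ^ 3) (B γ - 1#) Q ×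
    B γ ≈ Q + t ^ (m ∸ 3) * (x - 1#) * (B γ - 1# - t * B γ)
theorem17 m 1≤m m≢3 γ γ∈ l₁ l₂ _ = solution (m ∸ 3) (proj₂ (proj₂ (B-recursive 1≤m m≢3 γ∈ l₁ l₂)))
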